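{- Let $n$ be a positive integer and $0\le k\le n-1$. Let $B^S_{n,k}=\{\sigma\in S_n:\mathrm{del}_S(\sigma)=k\}$ and $B^A_{n+1,k}=\{\sigma\in A_{n+1}:\mathrm{del}_A(\sigma)=k\}$. Then (1) $\sum_{\sigma\in B^S_{n,k}}q^{\ell_S(\sigma)}=\sum_{\sigma\in B^S_{n,k}}q^{\mathrm{rmaj}_{S_n}(\sigma)}$, and (2) $\sum_{\sigma\in B^A_{n+1,k}}q^{\ell_A(\sigma)}=\sum_{\sigma\in B^A_{n+1,k}}q^{\mathrm{rmaj}_{A_{n+1}}(\sigma)}$.
   Context: Permutations are in one-line notation and multiplied as functions, $(\sigma\tau)(k)=\sigma(\tau(k))$; $s_i=(i,i+1)$. $\mathrm{Des}_S(\pi)=\{i\in[n-1]:\pi(i)>\pi(i+1)\}$, $\mathrm{rmaj}_{S_n}(\pi)=\sum_{i\in\mathrm{Des}_S(\pi)}(n-i)$, $\ell_S(\pi)$ = number of inversions. $R^S_j=\{1,s_j,s_js_{j-1},\dots,s_j\cdots s_1\}$ ($1\le j\le n-1$); every $w\in S_n$ factors uniquely as $w_1\cdots w_{n-1}$, $w_j\in R^S_j$, and $\mathrm{del}_S(w)$ is the number of $j$ with $w_j=s_j\cdots s_1$. In $S_{n+1}$, $a_i=s_1s_{i+1}$ ($1\le i\le n-1$); $R^A_j=\{1,a_j,a_ja_{j-1},\dots,a_j\cdots a_2,a_j\cdots a_2a_1,a_j\cdots a_2a_1^{ -1}\}$ (words; $R^A_1=\{1,a_1,a_1^{ -1}\}$).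 Every $v\in A_{n+1}$ factors uniquely as $v_1\cdots v_{n-1}$, $v_j\in R^A_j$; $\ell_A(v)$ = total number of letters, $\mathrm{del}_A(v)$ = number of letters $a_1^{\pm1}$. $\mathrm{Des}_A(\sigma)=\{1\le i\le n-1:\ell_A(\sigma)\ge\ell_A(\sigma a_i)\}$, $\mathrm{rmaj}_{A_{n+1}}(\sigma)=\sum_{i\in\mathrm{Des}_A(\sigma)}(n-i)$. -}

module Defs where

open import Data.Bool using (Bool; true; false; if_then_else_; _∧_; _∨_; not)
open import Data.Nat using (ℕ; zero; suc; _+_; _∸_; _≡ᵇ_; _<ᵇ_; _≤ᵇ_; _%_)
open import Data.List using (List; []; _∷_; _++_; map; concatMap; length; upTo; filterᵇ; foldr; and; all)
open import Data.Nat.ListAction using (sum)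
open import Data.Maybe using (Maybe; just; nothing; maybe)
open import Data.Product using (_×_; _,_; proj₁; proj₂)
open import Algebra.Bundles using (CommutativeSemiring)

-- Permutations of [N] = {1,…,N} in one-line notation, as lists of ℕ
-- [σ(1), …, σ(N)].

range1 : ℕ → List ℕ
range1 N = map suc (upTo N)

-- σ(k) (1-based); default k outside [1..length σ]
apply : List ℕ → ℕ → ℕ
apply []       k             = k
apply (x ∷ xs) zero          = zero
apply (x ∷ xs) (suc zero)    = x
apply (x ∷ xs) (suc (suc k)) = apply xs (suc k)

compose : List ℕ → List ℕ → List ℕ
compose σ τ = map (apply σ) τ

listEq : List ℕ → List ℕ → Bool
listEq []       []       = true
listEq (x ∷ xs) (y ∷ ys) = (x ≡ᵇ y) ∧ listEq xs ys
listEq _        _        = false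

elem : ℕ → List ℕ → Bool
elem x []       = false
elem x (y ∷ ys) = (x ≡ᵇ y) ∨ elem x ys

noDup : List ℕ → Bool
noDup []       = true
noDup (x ∷ xs) = not (elem x xs) ∧ noDup xs

allLists : ℕ → List ℕ → List (List ℕ)
allLists zero    vs = [] ∷ []
allLists (suc m) vs = concatMap (λ v → map (v ∷_) (allLists m vs)) vs

Sym : ℕ → List (List ℕ)
Sym N = filterᵇ noDup (allLists N (range1 N))

inversions : List ℕ → ℕ
inversions []       = 0
inversions (x ∷ xs) = length (filterᵇ (λ y → y <ᵇ x) xs) + inversions xs

Alt : ℕ → List (List ℕ)
Alt N = filterᵇ (λ σ → (inversions σ % 2) ≡ᵇ 0) (Sym N)

transp : ℕ → ℕ → ℕ → List ℕ
transp N i j = map (λ k → if k ≡ᵇ i then j else (if k ≡ᵇ j then i else k)) (range1 N)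

sGen : ℕ → ℕ → List ℕ
sGen N i = transp N i (suc i)

prod : ℕ → List (List ℕ) → List ℕ
prod N = foldr compose (range1 N)

choices : List ℕ → List (List ℕ)
choices []       = [] ∷ []
choices (b ∷ bs) = concatMap (λ c → map (c ∷_) (choices bs)) (upTo (suc b))

down : ℕ → ℕ → List ℕ
down j zero    = []
down j (suc t) = j ∷ down (j ∸ 1) t

findFirst : {A : Set} → (A → Bool) → List A → Maybe A
findFirst p []       = nothing
findFirst p (x ∷ xs) = if p x then just x else findFirst p xs

zipIdx : ℕ → List ℕ → List (ℕ × ℕ)
zipIdx j []       = []
zipIdx j (c ∷ cs) = (j , c) ∷ zipIdx (suc j) cs

count : {A : Set} → (A → Bool) → List A → ℕ
count p xs = length (filterᵇ p xs)

-- Type S.  R^S_j = {1, s_j, s_j s_{j-1}, …, s_j ⋯ s_1}; the element with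
-- choice t ∈ {0,…,j} is s_j s_{j-1} ⋯ s_{j-t+1} (t letters).
-- A factorization w₁ ⋯ w_{n-1} of w ∈ S_n is a choice sequence
-- [c₁, …, c_{n-1}] with c_j ∈ {0,…,j}.

wordS : List ℕ → List ℕ
wordS cs = concatMap (λ p → down (proj₁ p) (proj₂ p)) (zipIdx 1 cs)

evalS : ℕ → List ℕ → List ℕ
evalS n cs = prod n (map (sGen n) (wordS cs))

-- the (unique) factorization of σ ∈ S_n
factorS : ℕ → List ℕ → Maybe (List ℕ)
factorS n σ = findFirst (λ cs → listEq (evalS n cs) σ) (choices (range1 (n ∸ 1)))

-- del_S(σ): number of j with w_j = s_j ⋯ s_1
delS : ℕ → List ℕ → ℕ
delS n σ = maybe (λ cs → count (λ p → proj₁ p ≡ᵇ proj₂ p) (zipIdx 1 cs)) 0 (factorS n σ)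

rmajS : ℕ → List ℕ → ℕ
rmajS n π = sum (map (λ i → if apply π (suc i) <ᵇ apply π i then n ∸ i else 0) (range1 (n ∸ 1)))

-- Type A (in S_{n+1}).  a_i = s₁ s_{i+1};  letters a_i (i ≥ 1) and a₁⁻¹.

data LetterA : Set where
  a     : ℕ → LetterA
  a1inv : LetterA

aGen : ℕ → ℕ → List ℕ
aGen N i = compose (sGen N 1) (sGen N (suc i))

evalLetter : ℕ → LetterA → List ℕ
evalLetter N (a i) = aGen N i
evalLetter N a1inv = compose (sGen N 2) (sGen N 1)

isA1 : LetterA → Bool
isA1 (a i) = i ≡ᵇ 1
isA1 a1inv = true

-- R^A_j = {1, a_j, a_j a_{j-1}, …, a_j ⋯ a_2, a_j ⋯ a_2 a_1, a_j ⋯ a_2 a_1⁻¹}: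
-- choice t ∈ {0,…,j} gives a_j ⋯ a_{j-t+1}; t = j+1 gives a_j ⋯ a_2 a_1⁻¹.
wordAj : ℕ → ℕ → List LetterA
wordAj j t = if t ≤ᵇ j then map a (down j t) else (map a (down j (j ∸ 1)) ++ (a1inv ∷ []))

wordA : List ℕ → List LetterA
wordA cs = concatMap (λ p → wordAj (proj₁ p) (proj₂ p)) (zipIdx 1 cs)

evalA : ℕ → List ℕ → List ℕ
evalA n cs = prod (suc n) (map (evalLetter (suc n)) (wordA cs))

-- the (unique) factorization v₁ ⋯ v_{n-1} of v ∈ A_{n+1}; c_j ∈ {0,…,j+1}
factorA : ℕ → List ℕ → Maybe (List LetterA)
factorA n σ = maybe (λ cs → just (wordA cs)) nothing
  (findFirst (λ cs → listEq (evalA n cs) σ) (choices (map suc (range1 (n ∸ 1)))))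

lenA : ℕ → List ℕ → ℕ
lenA n σ = maybe length 0 (factorA n σ)

delA : ℕ → List ℕ → ℕ
delA n σ = maybe (count isA1) 0 (factorA n σ)

rmajA : ℕ → List ℕ → ℕ
rmajA n σ = sum (map (λ i → if lenA n (compose σ (aGen (suc n) i)) ≤ᵇ lenA n σ then n ∸ i else 0)
                     (range1 (n ∸ 1)))

module _ {c ℓ} (R : CommutativeSemiring c ℓ) where
  open CommutativeSemiring R using (Carrier; 1#; 0#) renaming (_+_ to _⊕_; _*_ to _⊛_)

  pow : Carrier → ℕ → Carrier
  pow q zero    = 1#
  pow q (suc m) = q ⊛ pow q m

  genSum : Carrier → (List ℕ → ℕ) → List (List ℕ) → Carrier
  genSum q stat xs = foldr (λ σ acc → pow q (stat σ) ⊕ acc) 0# xs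

BS : ℕ → ℕ → List (List ℕ)
BS n k = filterᵇ (λ σ → delS n σ ≡ᵇ k) (Sym n)

BA : ℕ → ℕ → List (List ℕ)
BA n k = filterᵇ (λ σ → delA n σ ≡ᵇ k) (Alt (suc n))

{-# OPTIONS --safe #-}

-- Both statistics are tracked through insertion of the largest letter.
-- Inserting it in front of a word ρ adds |ρ| to the inversion number and to
-- rmaj and adds one left-to-right minimum; over the other slots it adds each
-- of 0, …, |ρ|-1 exactly once to either statistic and no minimum.  The last
-- factor w_{n-1} of the canonical factorization is such an insertion, so
-- del_S is the number of left-to-right minima other than the first entry,
-- and (1) follows: both sums are the coefficient of t^k in
-- ∏_j (1 + q + ⋯ + q^{j-1} + t q^j).
-- For (2), let bubble σ be the result of one bubble-sort pass that carries
-- the running minimum to the right and then drops it.  It is invariant under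
-- exchanging the first two letters, and ℓ_A(σ), del_A(σ), Des_A(σ) are the
-- inversion number, the number of non-initial left-to-right minima and the
-- descent set of bubble σ.  Inserting the maximum in either of the first two
-- slots of σ inserts it in front of bubble σ, hence 2t instead of t; parity
-- does not matter, since for every function H the sum of H(bubble σ) is the
-- same over even and over odd σ.
module Submission where

open import Defs
open import Algebra.Bundles using (CommutativeSemiring)
open import Data.Bool using (Bool; true; false; if_then_else_; not; T)
open import Data.Bool.Properties using (T-≡; not-involutive)
open import Data.List using (List; []; _∷_; _++_; _∷ʳ_; map; concatMap; length; upTo; applyUpTo; filterᵇ; filter; foldr)
open import Data.List.Properties using (map-∘; map-id; map-applyUpTo; length-map; length-upTo; upTo-∷ʳ; map-++; ∷-injective; filter-all; length-++; filter-reject; filter-accept; map-id-local; map-cong-local; concatMap-++; ++-assoc; ++-identityʳ; filter-++; filter-none)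
open import Data.List.Membership.Propositional using (_∈_; find)
open import Data.List.Membership.Propositional.Properties
open import Data.List.Membership.Propositional.Properties.WithK using (unique∧set⇒bag)
open import Data.List.Relation.Binary.BagAndSetEquality using (∼bag⇒↭)
open import Data.List.Relation.Binary.Permutation.Propositional using (_↭_; refl; prep; swap; ↭-sym; ↭-trans; ↭-refl; ↭⇒↭ₛ)
open import Data.List.Relation.Binary.Permutation.Propositional.Properties using (All-resp-↭; ↭-length; ∈-resp-↭; shift; filter-↭)
import Data.List.Relation.Binary.Permutation.Setoid.Properties as PermutationSetoid
open import Data.List.Relation.Binary.Pointwise using (Pointwise; []; _∷_)
import Data.List.Relation.Binary.Pointwise as Pointwise
open import Data.List.Relation.Unary.All using (All; []; _∷_)
import Data.List.Relation.Unary.All as All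
import Data.List.Relation.Unary.All.Properties as All
open import Data.List.Relation.Unary.AllPairs using ([]; _∷_)
open import Data.List.Relation.Unary.Any using (here; there)
import Data.List.Relation.Unary.Any as Any
open import Data.List.Relation.Unary.Unique.Propositional using (Unique)
import Data.List.Relation.Unary.Unique.Propositional.Properties as Unique
open import Data.List.Reverse using (Reverse; []; _∶_∶ʳ_; reverseView)
open import Data.Maybe using (just)
open import Data.Nat using (ℕ; zero; suc; _+_; _∸_; _≤_; _<_; _⊔_; _⊓_; _<ᵇ_; _≤ᵇ_; _≡ᵇ_; _%_; z≤n; s≤s; s≤s⁻¹)
open import Data.Nat.ListAction using (sum)
import Data.Nat.Properties as ℕ
open import Data.Nat.Properties using (+-suc; +-∸-assoc; 1+n≰n; <-cmp; <-≤-connex; <ᵇ⇒<; <⇒<ᵇ; <⇒≢; <⇒≤; >⇒≢; m+n∸n≡m; m∸[m∸n]≡n; m∸n≤m; m≤m+n; m≤n⇒m<n∨m≡n; m≤n⇒m≤1+n; m≤n⇒m⊓n≡m; m≤n⇒m⊔n≡n; m≥n⇒m⊓n≡n; m≥n⇒m⊔n≡m; n∸n≡0; n≤1+n; suc-injective; ≡ᵇ⇒≡; ≡⇒≡ᵇ; ≤-<-trans; ≤-refl; ≤-total; ≤-trans; ≤⇒≤ᵇ; ≤⇒≯; ≤∧≢⇒<; _≟_; ⊔-comm; ⊓-comm; ⊔-lub; m⊓n≤m)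
open import Data.Product using (_×_; _,_; proj₁; proj₂; ∃)
open import Data.Sum using (_⊎_; inj₁; inj₂)
open import Function using (_∘_; id; Equivalence; mk⇔; _$_)
open import Relation.Binary.Definitions using (tri<; tri≈; tri>)
open import Relation.Binary.PropositionalEquality using (_≡_; _≢_; refl; sym; trans; cong; cong₂; subst; subst₂; setoid; module ≡-Reasoning)
import Relation.Binary.Reasoning.Setoid
open import Relation.Nullary using (¬_; yes; no; contradiction)
open import Relation.Nullary.Decidable using (¬?; T?)

-- Permutations as duplicate-free lists over 1, ..., N

<ᵇ-true : ∀ {m n} → m < n → (m <ᵇ n) ≡ true
<ᵇ-true m<n = Equivalence.to T-≡ (<⇒<ᵇ m<n)

<ᵇ-false : ∀ {m n} → n ≤ m → (m <ᵇ n) ≡ false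
<ᵇ-false {m} {n} n≤m with m <ᵇ n in eq
... | false = refl
... | true  = contradiction (<ᵇ⇒< m n (Equivalence.from T-≡ eq)) (≤⇒≯ n≤m)

Unique-resp-↭ : ∀ {A : Set} {xs ys : List A} → xs ↭ ys → Unique xs → Unique ys
Unique-resp-↭ p = PermutationSetoid.Unique-resp-↭ (setoid _) (↭⇒↭ₛ p)

range1-∷ʳ : ∀ N → range1 (suc N) ≡ range1 N ∷ʳ suc N
range1-∷ʳ N = trans (cong (map suc) (sym (upTo-∷ʳ N))) (map-++ suc (upTo N) (N ∷ []))

length-range1 : ∀ N → length (range1 N) ≡ N
length-range1 N = trans (length-map suc (upTo N)) (length-upTo N)

InRange : ℕ → ℕ → Set
InRange N k = 1 ≤ k × k ≤ N

∈-range1⁺ : ∀ {N k} → InRange N k → k ∈ range1 N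
∈-range1⁺ {k = suc k} (_ , k<N) = ∈-map⁺ suc (∈-upTo⁺ k<N)

∈-range1⁻ : ∀ {N k} → k ∈ range1 N → InRange N k
∈-range1⁻ k∈ with _ , i∈ , refl ← ∈-map⁻ suc k∈ = s≤s z≤n , ∈-upTo⁻ i∈

-- Propositional form of membership in `Sym N`. It only asks for distinct letters in range; that the
-- largest letter occurs is recovered by counting in `max∈perm`.
record IsPerm (N : ℕ) (σ : List ℕ) : Set where
  constructor isPerm
  field
    len    : length σ ≡ N
    bound  : All (InRange N) σ
    unique : Unique σ
open IsPerm

IsPerm-resp-↭ : ∀ {N σ τ} → σ ↭ τ → IsPerm N σ → IsPerm N τ
IsPerm-resp-↭ p (isPerm l b u) =
  isPerm (trans (sym (↭-length p)) l) (All-resp-↭ p b) (Unique-resp-↭ p u)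

elem-false⇒∉ : ∀ x ys → elem x ys ≡ false → All (x ≢_) ys
elem-false⇒∉ x []       eq = []
elem-false⇒∉ x (y ∷ ys) eq with x ≡ᵇ y in e
... | false = (λ { refl → contradiction (trans (sym e) (Equivalence.to T-≡ (≡⇒≡ᵇ x x refl))) λ () }) ∷ elem-false⇒∉ x ys eq

∉⇒elem-false : ∀ x ys → All (x ≢_) ys → elem x ys ≡ false
∉⇒elem-false x []       []       = refl
∉⇒elem-false x (y ∷ ys) (x≢y ∷ x∉) with x ≡ᵇ y in e
... | false = ∉⇒elem-false x ys x∉
... | true  = contradiction (≡ᵇ⇒≡ x y (Equivalence.from T-≡ e)) x≢y

noDup⇒Unique : ∀ xs → T (noDup xs) → Unique xs
noDup⇒Unique []       _ = []
noDup⇒Unique (x ∷ xs) t with elem x xs in e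
... | false = elem-false⇒∉ x xs e ∷ noDup⇒Unique xs t

Unique⇒noDup : ∀ xs → Unique xs → T (noDup xs)
Unique⇒noDup []       _ = _
Unique⇒noDup (x ∷ xs) (x∉ ∷ u) rewrite ∉⇒elem-false x xs x∉ = Unique⇒noDup xs u

∈-allLists⁺ : ∀ {vs} σ → All (_∈ vs) σ → σ ∈ allLists (length σ) vs
∈-allLists⁺ []      _          = here refl
∈-allLists⁺ (x ∷ σ) (x∈ ∷ σ⊆) =
  ∈-concatMap⁺ _ (Any.map (λ { refl → ∈-map⁺ (x ∷_) (∈-allLists⁺ σ σ⊆) }) x∈)

∈-allLists⁻ : ∀ {vs} m {σ} → σ ∈ allLists m vs → length σ ≡ m × All (_∈ vs) σ
∈-allLists⁻ zero (here refl) = refl , []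
∈-allLists⁻ {vs} (suc m) σ∈
  with v , v∈ , σ∈′ ← find (∈-concatMap⁻ (λ v → map (v ∷_) (allLists m vs)) {xs = vs} σ∈)
  with τ , τ∈ , refl ← ∈-map⁻ (v ∷_) σ∈′
  with l , τ⊆ ← ∈-allLists⁻ m τ∈ = cong suc l , v∈ ∷ τ⊆

∈-Sym⁺ : ∀ {N σ} → IsPerm N σ → σ ∈ Sym N
∈-Sym⁺ {N} {σ} (isPerm refl b u) =
  ∈-filter⁺ (T? ∘ noDup) (∈-allLists⁺ σ (All.map ∈-range1⁺ b)) (Unique⇒noDup σ u)

∈-Sym⁻ : ∀ N {σ} → σ ∈ Sym N → IsPerm N σ
∈-Sym⁻ N {σ} σ∈ with σ∈′ , nd ← ∈-filter⁻ (T? ∘ noDup) {xs = allLists N (range1 N)} σ∈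
  with l , b ← ∈-allLists⁻ N σ∈′ = isPerm l (All.map ∈-range1⁻ b) (noDup⇒Unique σ nd)

concatMap-unique : ∀ {A B : Set} {h : A → List B} {xs} → Unique xs →
  (∀ {x} → x ∈ xs → Unique (h x)) →
  (∀ {x y z} → x ∈ xs → y ∈ xs → z ∈ h x → z ∈ h y → x ≡ y) →
  Unique (concatMap h xs)
concatMap-unique [] _ _ = []
concatMap-unique {h = h} (x∉ ∷ u) uh dis =
  Unique.++⁺ (uh (here refl)) (concatMap-unique u (uh ∘ there) (λ p q → dis (there p) (there q)))
    λ (z∈ , z∈′) → let y , y∈ , z∈y = find (∈-concatMap⁻ h z∈′) in
      All.lookup x∉ y∈ (dis (here refl) (there y∈) z∈ z∈y)

allLists-unique : ∀ m {vs} → Unique vs → Unique (allLists m vs)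
allLists-unique zero    _ = [] ∷ []
allLists-unique (suc m) {vs} u = concatMap-unique u
  (λ _ → Unique.map⁺ (proj₂ ∘ ∷-injective) (allLists-unique m u))
  (λ {x} {y} _ _ z∈ z∈′ → case (∈-map⁻ (x ∷_) z∈) (∈-map⁻ (y ∷_) z∈′))
  where
  case : ∀ {x y z} → (∃ λ t → t ∈ allLists m vs × z ≡ x ∷ t) → (∃ λ t → t ∈ allLists m vs × z ≡ y ∷ t) → x ≡ y
  case (_ , _ , refl) (_ , _ , e) = proj₁ (∷-injective e)

Sym-unique : ∀ N → Unique (Sym N)
Sym-unique N = Unique.filter⁺ (T? ∘ noDup) (allLists-unique N (Unique.map⁺ suc-injective (Unique.upTo⁺ N)))

-- Insertion of a letter

ins : ℕ → ℕ → List ℕ → List ℕ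
ins zero    M τ       = M ∷ τ
ins (suc p) M []      = M ∷ []
ins (suc p) M (x ∷ τ) = x ∷ ins p M τ

insertAll : ℕ → List ℕ → List (List ℕ)
insertAll M []      = (M ∷ []) ∷ []
insertAll M (x ∷ τ) = (M ∷ x ∷ τ) ∷ map (x ∷_) (insertAll M τ)

insertAll-ins : ∀ M τ → insertAll M τ ≡ map (λ p → ins p M τ) (upTo (suc (length τ)))
insertAll-ins M []      = refl
insertAll-ins M (x ∷ τ) = cong ((M ∷ x ∷ τ) ∷_) (trans (cong (map (x ∷_)) (insertAll-ins M τ))
  (trans (sym (map-∘ (upTo (suc (length τ)))))
  (trans (map-applyUpTo id _ (suc (length τ))) (sym (map-applyUpTo suc _ (suc (length τ)))))))

ins-∈-insertAll : ∀ p M τ → p ≤ length τ → ins p M τ ∈ insertAll M τ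
ins-∈-insertAll p M τ p≤ rewrite insertAll-ins M τ = ∈-map⁺ (λ p → ins p M τ) (∈-upTo⁺ (s≤s p≤))

insertAll-↭ : ∀ {M} τ {z} → z ∈ insertAll M τ → z ↭ M ∷ τ
insertAll-↭ []      (here refl) = ↭-refl
insertAll-↭ (x ∷ τ) (here refl) = ↭-refl
insertAll-↭ (x ∷ τ) (there z∈) with t , t∈ , refl ← ∈-map⁻ (x ∷_) z∈ =
  ↭-trans (prep x (insertAll-↭ τ t∈)) (swap x _ ↭-refl)

ins-++ : ∀ α M β → ins (length α) M (α ++ β) ≡ α ++ M ∷ β
ins-++ []      M β = refl
ins-++ (x ∷ α) M β = cong (x ∷_) (ins-++ α M β)

remove : ℕ → List ℕ → List ℕ
remove M = filter (λ x → ¬? (x ≟ M))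

-- Deleting `M` undoes every insertion, so the lists `insertAll M τ` for different `τ` are disjoint.
-- This is what makes the right side of `Sym-suc` duplicate-free.
remove-insertAll : ∀ {M} τ → All (_≢ M) τ → ∀ {z} → z ∈ insertAll M τ → remove M z ≡ τ
remove-insertAll {M} []      _ (here refl) = filter-reject (λ x → ¬? (x ≟ M)) (λ f → f refl)
remove-insertAll {M} (x ∷ τ) τ≢ (here refl) =
  trans (filter-reject (λ x → ¬? (x ≟ M)) (λ f → f refl)) (filter-all (λ x → ¬? (x ≟ M)) τ≢)
remove-insertAll {M} (x ∷ τ) (x≢ ∷ τ≢) (there z∈) with t , t∈ , refl ← ∈-map⁻ (x ∷_) z∈ =
  trans (filter-accept (λ x → ¬? (x ≟ M)) x≢) (cong (x ∷_) (remove-insertAll τ τ≢ t∈))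

insertAll-unique : ∀ {M} τ → All (_≢ M) τ → Unique (insertAll M τ)
insertAll-unique []      _        = [] ∷ []
insertAll-unique (x ∷ τ) (x≢ ∷ τ≢) =
  All.map⁺ (All.universal (λ _ e → x≢ (sym (proj₁ (∷-injective e)))) _) ∷
  Unique.map⁺ (proj₂ ∘ ∷-injective) (insertAll-unique τ τ≢)

-- Pigeonhole principle, by deleting one occurrence of the head of `xs` from `ys`.
length-≤-of-⊆ : ∀ {A : Set} {xs ys : List A} → Unique xs → All (_∈ ys) xs → length xs ≤ length ys
length-≤-of-⊆ [] _ = z≤n
length-≤-of-⊆ {xs = x ∷ xs} (x∉ ∷ u) (x∈ ∷ xs⊆) with as , bs , refl ← ∈-∃++ x∈ =
  subst (_ ≤_) (sym (↭-length (shift x as bs)))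
    (s≤s (length-≤-of-⊆ u (All.zipWith other (x∉ , xs⊆))))
  where
  other : ∀ {y} → x ≢ y × y ∈ as ++ x ∷ bs → y ∈ as ++ bs
  other (x≢y , y∈) with ∈-resp-↭ (shift x as bs) y∈
  ... | here refl = contradiction refl x≢y
  ... | there y∈′ = y∈′

-- If `suc N` were missing, `suc N` distinct letters would all lie in `range1 N`, against the
-- pigeonhole bound.
max∈perm : ∀ {N σ} → IsPerm (suc N) σ → suc N ∈ σ
max∈perm {N} {σ} (isPerm l b u) with Any.any? (suc N ≟_) σ
... | yes M∈ = M∈
... | no  M∉ = contradiction
  (subst₂ _≤_ l (length-range1 N) (length-≤-of-⊆ u (All.zipWith smaller (b , All.¬Any⇒All¬ σ M∉))))
  1+n≰n
  where
  smaller : ∀ {k} → InRange (suc N) k × suc N ≢ k → k ∈ range1 N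
  smaller ((1≤k , k≤) , ≢k) = ∈-range1⁺ (1≤k , s≤s⁻¹ (≤∧≢⇒< k≤ (≢k ∘ sym)))

perm-below : ∀ {N σ} → IsPerm N σ → All (_< suc N) σ
perm-below s = All.map (s≤s ∘ proj₂) (bound s)

perm-insert : ∀ {N τ z} → IsPerm N τ → z ∈ insertAll (suc N) τ → IsPerm (suc N) z
perm-insert {N} {τ} s@(isPerm l b u) z∈ = IsPerm-resp-↭ (↭-sym (insertAll-↭ τ z∈))
  (isPerm (cong suc l) ((s≤s z≤n , ≤-refl) ∷ All.map (λ (p , q) → p , m≤n⇒m≤1+n q) b)
    (All.map >⇒≢ (perm-below s) ∷ u))

perm-uninsert : ∀ {N σ} → IsPerm (suc N) σ →
  ∃ λ τ → ∃ λ p → IsPerm N τ × p ≤ N × σ ≡ ins p (suc N) τ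
perm-uninsert {N} s with α , β , refl ← ∈-∃++ (max∈perm s)
  with isPerm l (_ ∷ b) (M∉ ∷ u) ← IsPerm-resp-↭ (shift (suc N) α β) s =
  α ++ β , length α ,
  isPerm (suc-injective l)
    (All.zipWith (λ ((p , q) , ≢k) → p , s≤s⁻¹ (≤∧≢⇒< q (≢k ∘ sym))) (b , M∉)) u ,
  subst (length α ≤_) (trans (sym (length-++ α)) (suc-injective l)) (m≤m+n _ _) ,
  sym (ins-++ α (suc N) β)

-- The two sides enumerate in different orders, so they agree only up to `↭`. This follows from
-- having the same members and no duplicates.
Sym-suc : ∀ N → Sym (suc N) ↭ concatMap (insertAll (suc N)) (Sym N)
Sym-suc N = ∼bag⇒↭ $ unique∧set⇒bag (Sym-unique (suc N))
  (concatMap-unique (Sym-unique N)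
    (λ τ∈ → insertAll-unique _ (≢max τ∈))
    (λ {x} {y} x∈ y∈ z∈ z∈′ → trans (sym (remove-insertAll x (≢max x∈) z∈)) (remove-insertAll y (≢max y∈) z∈′)))
  (mk⇔ to from)
  where
  ≢max : ∀ {τ} → τ ∈ Sym N → All (_≢ suc N) τ
  ≢max τ∈ = All.map <⇒≢ (perm-below (∈-Sym⁻ N τ∈))
  to : ∀ {σ} → σ ∈ Sym (suc N) → σ ∈ concatMap (insertAll (suc N)) (Sym N)
  to σ∈ with τ , p , sτ , p≤N , refl ← perm-uninsert (∈-Sym⁻ (suc N) σ∈) =
    ∈-concatMap⁺ (insertAll (suc N)) (Any.map (λ { refl → ins-∈-insertAll p (suc N) τ (subst (p ≤_) (sym (len sτ)) p≤N) }) (∈-Sym⁺ sτ))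
  from : ∀ {σ} → σ ∈ concatMap (insertAll (suc N)) (Sym N) → σ ∈ Sym (suc N)
  from σ∈ with τ , τ∈ , σ∈′ ← find (∈-concatMap⁻ (insertAll (suc N)) σ∈) =
    ∈-Sym⁺ (perm-insert (∈-Sym⁻ N τ∈) σ∈′)

-- Parity and the statistics on words

isEven : ℕ → Bool
isEven zero    = true
isEven (suc n) = not (isEven n)

%2≡ᵇ0 : ∀ n → (n % 2 ≡ᵇ 0) ≡ isEven n
%2≡ᵇ0 zero          = refl
%2≡ᵇ0 (suc zero)    = refl
%2≡ᵇ0 (suc (suc n)) = trans (%2≡ᵇ0 n) (sym (not-involutive (isEven n)))

smaller : ℕ → List ℕ → ℕ
smaller x σ = length (filterᵇ (λ y → y <ᵇ x) σ)

smaller-∷-< : ∀ {x y} σ → y < x → smaller x (y ∷ σ) ≡ suc (smaller x σ)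
smaller-∷-< {x} σ y<x = cong length (filter-accept (λ y → T? (y <ᵇ x)) (<⇒<ᵇ y<x))

smaller-∷-≥ : ∀ {x y} σ → x ≤ y → smaller x (y ∷ σ) ≡ smaller x σ
smaller-∷-≥ {x} σ x≤y = cong length (filter-reject (λ y → T? (y <ᵇ x)) (≤⇒≯ x≤y ∘ <ᵇ⇒< _ _))

smaller-all : ∀ {M} σ → All (_< M) σ → smaller M σ ≡ length σ
smaller-all {M} σ σ< = cong length (filter-all (λ y → T? (y <ᵇ M)) (All.map <⇒<ᵇ σ<))

smaller-↭ : ∀ x {σ τ} → σ ↭ τ → smaller x σ ≡ smaller x τ
smaller-↭ x p = ↭-length (filter-↭ (λ y → T? (y <ᵇ x)) p)

-- `m` is the running minimum. `del` starts it at the first letter, which is therefore not counted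
-- among the left-to-right minima.
minimaBelow : ℕ → List ℕ → ℕ
minimaBelow m []      = 0
minimaBelow m (u ∷ σ) = if u <ᵇ m then suc (minimaBelow u σ) else minimaBelow m σ

del : List ℕ → ℕ
del []      = 0
del (x ∷ σ) = minimaBelow x σ

-- `x` is the preceding letter. The weight n - i of a descent is the number of letters after
-- position i, so it can be read off the remaining word without knowing n.
rmajFrom : ℕ → List ℕ → ℕ
rmajFrom x []      = 0
rmajFrom x (y ∷ σ) = (if y <ᵇ x then suc (length σ) else 0) + rmajFrom y σ

rmaj : List ℕ → ℕ
rmaj []      = 0
rmaj (x ∷ σ) = rmajFrom x σ

applyUpTo-cong : ∀ {A : Set} {f g : ℕ → A} → (∀ k → f k ≡ g k) → ∀ N → applyUpTo f N ≡ applyUpTo g N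
applyUpTo-cong e zero    = refl
applyUpTo-cong e (suc N) = cong₂ _∷_ (e 0) (applyUpTo-cong (e ∘ suc) N)

map-range1 : ∀ {A : Set} (g : ℕ → A) N → map g (range1 N) ≡ applyUpTo (g ∘ suc) N
map-range1 g N = trans (cong (map g) (map-applyUpTo id suc N)) (map-applyUpTo suc g N)

rmajS-rmaj : ∀ σ → rmajS (length σ) σ ≡ rmaj σ
rmajS-rmaj []      = refl
rmajS-rmaj (x ∷ σ) = trans (cong sum (map-range1 _ (length σ))) (go x σ)
  where
  go : ∀ x σ → sum (applyUpTo (λ i → if apply (x ∷ σ) (2 + i) <ᵇ apply (x ∷ σ) (1 + i) then length σ ∸ i else 0) (length σ)) ≡ rmajFrom x σ
  go x []      = refl
  go x (y ∷ σ) = cong ((if y <ᵇ x then suc (length σ) else 0) +_) (go y σ)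

-- A largest letter that is not the first one never undercuts the running minimum.
ins-suc-del : ∀ {M} p x τ → All (_< M) (x ∷ τ) → del (ins (suc p) M (x ∷ τ)) ≡ del (x ∷ τ)
ins-suc-del zero x τ (x< ∷ _) rewrite <ᵇ-false (<⇒≤ x<) = refl
ins-suc-del (suc p) x [] (x< ∷ _) rewrite <ᵇ-false (<⇒≤ x<) = refl
ins-suc-del (suc p) x (y ∷ τ) (x< ∷ y< ∷ τ<) with y <ᵇ x
... | true  = cong suc (ins-suc-del p y τ (y< ∷ τ<))
... | false = ins-suc-del p x τ (x< ∷ τ<)

insertAll-del : ∀ {M} x τ → All (_< M) (x ∷ τ) → ∀ {z} → z ∈ insertAll M τ → del (x ∷ z) ≡ del (x ∷ τ)
insertAll-del {M} x τ τ< {z} z∈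
  with p , _ , refl ← ∈-map⁻ (λ p → ins p M τ) {xs = upTo (suc (length τ))} (subst (z ∈_) (insertAll-ins M τ) z∈) =
  ins-suc-del p x τ τ<

ins-zero-del : ∀ {M} x τ → x < M → del (M ∷ x ∷ τ) ≡ suc (del (x ∷ τ))
ins-zero-del x τ x< rewrite <ᵇ-true x< = refl

smaller-ins : ∀ {M x} p τ → x < M → smaller x (ins p M τ) ≡ smaller x τ
smaller-ins zero    τ       x< = smaller-∷-≥ τ (<⇒≤ x<)
smaller-ins (suc p) []      x< = smaller-∷-≥ [] (<⇒≤ x<)
smaller-ins {x = x} (suc p) (y ∷ τ) x< with y <ᵇ x
... | true  = cong suc (smaller-ins p τ x<)
... | false = smaller-ins p τ x<

-- The largest letter is inverted with exactly the letters to its right, and the inversions among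
-- the other letters are unaffected.
inversions-ins : ∀ {M} p τ → All (_< M) τ → p ≤ length τ →
  inversions (ins p M τ) ≡ (length τ ∸ p) + inversions τ
inversions-ins zero    τ       τ< _ = cong (_+ inversions τ) (smaller-all τ τ<)
inversions-ins (suc p) (x ∷ τ) (x< ∷ τ<) (s≤s p≤) = trans
  (cong₂ _+_ (smaller-ins p τ x<) (inversions-ins p τ τ< p≤))
  (trans (sym (ℕ.+-assoc (smaller x τ) _ _)) (trans (cong (_+ inversions τ) (ℕ.+-comm (smaller x τ) _)) (ℕ.+-assoc (length τ ∸ p) _ _)))

-- Adjacent transpositions

-- Right multiplication by s_i, as `compose-sGen` shows. Index 0 and indices without a right
-- neighbour leave the word unchanged.
swapAt : ℕ → List ℕ → List ℕ
swapAt zero          σ           = σ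
swapAt (suc i)       []          = []
swapAt (suc zero)    (x ∷ [])    = x ∷ []
swapAt (suc zero)    (x ∷ y ∷ σ) = y ∷ x ∷ σ
swapAt (suc (suc i)) (x ∷ σ)     = x ∷ swapAt (suc i) σ

SwapIndex : ℕ → ℕ → Set
SwapIndex N i = 1 ≤ i × i < N

swapAt-↭ : ∀ i σ → swapAt i σ ↭ σ
swapAt-↭ zero          σ           = ↭-refl
swapAt-↭ (suc i)       []          = ↭-refl
swapAt-↭ (suc zero)    (x ∷ [])    = ↭-refl
swapAt-↭ (suc zero)    (x ∷ y ∷ σ) = swap y x ↭-refl
swapAt-↭ (suc (suc i)) (x ∷ σ)     = prep x (swapAt-↭ (suc i) σ)

swapAt-1-involutive : ∀ σ → swapAt 1 (swapAt 1 σ) ≡ σ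
swapAt-1-involutive []          = refl
swapAt-1-involutive (x ∷ [])    = refl
swapAt-1-involutive (x ∷ y ∷ σ) = refl

swapAt-++ : ∀ α {x y β} → swapAt (suc (length α)) (α ++ x ∷ y ∷ β) ≡ α ++ y ∷ x ∷ β
swapAt-++ []      = refl
swapAt-++ (z ∷ α) = cong (z ∷_) (swapAt-++ α)

swapAt-∷ʳ : ∀ i τ M → i < length τ → swapAt i (τ ∷ʳ M) ≡ swapAt i τ ∷ʳ M
swapAt-∷ʳ zero          τ           M _        = refl
swapAt-∷ʳ (suc zero)    (x ∷ [])    M (s≤s ())
swapAt-∷ʳ (suc zero)    (x ∷ y ∷ τ) M _        = refl
swapAt-∷ʳ (suc (suc i)) (x ∷ τ)     M (s≤s i<) = cong (x ∷_) (swapAt-∷ʳ (suc i) τ M i<)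

isDescent : ℕ → List ℕ → Bool
isDescent i σ = apply σ (suc i) <ᵇ apply σ i

inversions-swap-< : ∀ {x y} σ → y < x → inversions (x ∷ y ∷ σ) ≡ suc (inversions (y ∷ x ∷ σ))
inversions-swap-< {x} {y} σ y<x rewrite smaller-∷-< σ y<x | smaller-∷-≥ σ (<⇒≤ y<x) =
  cong suc (trans (sym (ℕ.+-assoc (smaller x σ) _ _))
    (trans (cong (_+ inversions σ) (ℕ.+-comm (smaller x σ) _)) (ℕ.+-assoc (smaller y σ) _ _)))

-- Only the exchanged pair changes its relative order: a letter in front sees the same letters
-- behind it (`smaller-↭`). Distinctness excludes a tie.
inversions-swapAt : ∀ i σ → Unique σ → SwapIndex (length σ) i →
  (isDescent i σ ≡ true × inversions σ ≡ suc (inversions (swapAt i σ))) ⊎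
  (isDescent i σ ≡ false × inversions (swapAt i σ) ≡ suc (inversions σ))
inversions-swapAt (suc zero) (x ∷ []) _ (_ , s≤s ())
inversions-swapAt (suc zero) (x ∷ y ∷ σ) ((x≢y ∷ _) ∷ _) _ with <-cmp x y
... | tri< x<y _ _ = inj₂ (<ᵇ-false (<⇒≤ x<y) , inversions-swap-< σ x<y)
... | tri≈ _ x≡y _ = contradiction x≡y x≢y
... | tri> _ _ y<x = inj₁ (<ᵇ-true y<x , inversions-swap-< σ y<x)
inversions-swapAt (suc (suc i)) (x ∷ σ) (_ ∷ u) (_ , s≤s i<)
  with inversions-swapAt (suc i) σ u (s≤s z≤n , i<) | smaller-↭ x (swapAt-↭ (suc i) σ)
... | inj₁ (d , e) | s = inj₁ (d , trans (cong (smaller x σ +_) e)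
        (trans (+-suc (smaller x σ) _) (cong (λ k → suc (k + _)) (sym s))))
... | inj₂ (d , e) | s = inj₂ (d , trans (cong₂ _+_ s e) (+-suc (smaller x σ) _))

swapAt-parity : ∀ i σ → Unique σ → SwapIndex (length σ) i →
  isEven (inversions (swapAt i σ)) ≡ not (isEven (inversions σ))
swapAt-parity i σ u i∈ with inversions-swapAt i σ u i∈
... | inj₁ (_ , e) = sym (trans (cong (not ∘ isEven) e) (not-involutive _))
... | inj₂ (_ , e) = cong isEven e

-- The inversion number changes by exactly one, so the weak comparison is as good as a strict one.
isDescent-inversions : ∀ i σ → Unique σ → SwapIndex (length σ) i →
  (inversions (swapAt i σ) ≤ᵇ inversions σ) ≡ isDescent i σ
isDescent-inversions i σ u i∈ with inversions-swapAt i σ u i∈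
... | inj₁ (d , e) rewrite d | e = Equivalence.to T-≡ (≤⇒≤ᵇ (n≤1+n (inversions (swapAt i σ))))
... | inj₂ (d , e) rewrite d | e = <ᵇ-false (≤-refl {inversions σ})

-- One pass of bubble sort

bubbleFrom : ℕ → List ℕ → List ℕ
bubbleFrom h []      = []
bubbleFrom h (u ∷ σ) = h ⊔ u ∷ bubbleFrom (h ⊓ u) σ

bubble : List ℕ → List ℕ
bubble []      = []
bubble (x ∷ σ) = bubbleFrom x σ

length-bubbleFrom : ∀ h σ → length (bubbleFrom h σ) ≡ length σ
length-bubbleFrom h []      = refl
length-bubbleFrom h (u ∷ σ) = cong suc (length-bubbleFrom (h ⊓ u) σ)

-- `m` is the minimum dropped at the end of the pass. Putting it back gives a rearrangement of the
-- input, which transfers distinctness and bounds to `bubble`.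
bubbleFrom-↭ : ∀ h σ → ∃ λ m → h ∷ σ ↭ m ∷ bubbleFrom h σ
bubbleFrom-↭ h []      = h , ↭-refl
bubbleFrom-↭ h (u ∷ σ) with m , p ← bubbleFrom-↭ (h ⊓ u) σ with ≤-total h u
... | inj₁ h≤u rewrite m≤n⇒m⊔n≡n h≤u | m≤n⇒m⊓n≡m h≤u =
  m , ↭-trans (swap h u ↭-refl) (↭-trans (prep u p) (swap u m ↭-refl))
... | inj₂ u≤h rewrite m≥n⇒m⊔n≡m u≤h | m≥n⇒m⊓n≡n u≤h =
  m , ↭-trans (prep h p) (swap h m ↭-refl)

bubble-unique : ∀ σ → Unique σ → Unique (bubble σ)
bubble-unique []      u = u
bubble-unique (x ∷ σ) u with m , p ← bubbleFrom-↭ x σ with _ ∷ u′ ← Unique-resp-↭ p u = u′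

bubble-All : ∀ {P : ℕ → Set} σ → All P σ → All P (bubble σ)
bubble-All []      ps = ps
bubble-All (x ∷ σ) ps with m , p ← bubbleFrom-↭ x σ with _ ∷ qs ← All-resp-↭ p ps = qs

bubble-swapAt-1 : ∀ σ → bubble (swapAt 1 σ) ≡ bubble σ
bubble-swapAt-1 []          = refl
bubble-swapAt-1 (x ∷ [])    = refl
bubble-swapAt-1 (x ∷ y ∷ σ) = cong₂ (λ u v → u ∷ bubbleFrom v σ) (⊔-comm y x) (⊓-comm y x)

-- The letter carried on arrival at the exchanged pair decides. If both letters are below it, the
-- pass emits the carried letter and then the larger of the two in either order, which is a descent.
-- Otherwise at least one of them is emitted as it is read, and the exchange shows up at the same
-- place of the output.
bubbleFrom-swapAt : ∀ i h σ → SwapIndex (length σ) i →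
  (bubbleFrom h (swapAt i σ) ≡ bubbleFrom h σ × isDescent i (bubbleFrom h σ) ≡ true) ⊎
  bubbleFrom h (swapAt i σ) ≡ swapAt i (bubbleFrom h σ)
bubbleFrom-swapAt (suc zero) h (u ∷ []) (_ , s≤s ())
bubbleFrom-swapAt (suc zero) h (u ∷ w ∷ σ) _ with <-≤-connex u h | <-≤-connex w h
... | inj₁ u<h | inj₁ w<h
  rewrite m≥n⇒m⊔n≡m (<⇒≤ u<h) | m≥n⇒m⊔n≡m (<⇒≤ w<h) | m≥n⇒m⊓n≡n (<⇒≤ u<h) | m≥n⇒m⊓n≡n (<⇒≤ w<h)
  = inj₁ (cong₂ (λ x y → h ∷ x ∷ bubbleFrom y σ) (⊔-comm w u) (⊓-comm w u) , <ᵇ-true (⊔-lub u<h w<h))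
... | inj₁ u<h | inj₂ h≤w
  rewrite m≥n⇒m⊔n≡m (<⇒≤ u<h) | m≤n⇒m⊔n≡n h≤w | m≥n⇒m⊓n≡n (<⇒≤ u<h) | m≤n⇒m⊓n≡m h≤w
  | m≥n⇒m⊔n≡m (<⇒≤ u<h) | m≤n⇒m⊔n≡n (≤-trans (<⇒≤ u<h) h≤w) | m≥n⇒m⊓n≡n (<⇒≤ u<h) | m≤n⇒m⊓n≡m (≤-trans (<⇒≤ u<h) h≤w)
  = inj₂ refl
... | inj₂ h≤u | inj₁ w<h
  rewrite m≥n⇒m⊔n≡m (<⇒≤ w<h) | m≤n⇒m⊔n≡n h≤u | m≥n⇒m⊓n≡n (<⇒≤ w<h) | m≤n⇒m⊓n≡m h≤u
  | m≥n⇒m⊔n≡m (<⇒≤ w<h) | m≤n⇒m⊔n≡n (≤-trans (<⇒≤ w<h) h≤u) | m≥n⇒m⊓n≡n (<⇒≤ w<h) | m≤n⇒m⊓n≡m (≤-trans (<⇒≤ w<h) h≤u)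
  = inj₂ refl
... | inj₂ h≤u | inj₂ h≤w
  rewrite m≤n⇒m⊔n≡n h≤u | m≤n⇒m⊓n≡m h≤u | m≤n⇒m⊔n≡n h≤w | m≤n⇒m⊓n≡m h≤w | m≤n⇒m⊔n≡n h≤u | m≤n⇒m⊓n≡m h≤u
  = inj₂ refl
bubbleFrom-swapAt (suc (suc i)) h (u ∷ σ) (_ , s≤s i<) with bubbleFrom-swapAt (suc i) (h ⊓ u) σ (s≤s z≤n , i<)
... | inj₁ (e , d) = inj₁ (cong (h ⊔ u ∷_) e , d)
... | inj₂ e       = inj₂ (cong (h ⊔ u ∷_) e)

-- An adjacent exchange that leaves the bubble pass unchanged happens at a
-- descent of the pass, so it agrees with the weak inequality of Des_A.
bubble-descent : ∀ i σ → Unique σ → 1 ≤ i → suc i < length σ →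
  (inversions (bubble (swapAt (suc i) σ)) ≤ᵇ inversions (bubble σ)) ≡ isDescent i (bubble σ)
bubble-descent (suc i) (x ∷ σ) u _ (s≤s i<) with bubbleFrom-swapAt (suc i) x σ (s≤s z≤n , i<)
... | inj₁ (e , d) rewrite e | d = Equivalence.to T-≡ (≤⇒≤ᵇ (≤-refl {inversions (bubbleFrom x σ)}))
... | inj₂ e rewrite e = isDescent-inversions (suc i) (bubbleFrom x σ) (bubble-unique (x ∷ σ) u)
        (s≤s z≤n , subst (suc i <_) (sym (length-bubbleFrom x σ)) i<)

-- A letter above everything else is emitted as soon as it is read and leaves the carried minimum
-- unchanged.
bubbleFrom-ins : ∀ {M} p h τ → h < M → All (_< M) τ → bubbleFrom h (ins p M τ) ≡ ins p M (bubbleFrom h τ)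
bubbleFrom-ins zero    h τ       h< _ rewrite m≤n⇒m⊔n≡n (<⇒≤ h<) | m≤n⇒m⊓n≡m (<⇒≤ h<) = refl
bubbleFrom-ins (suc p) h []      h< _ rewrite m≤n⇒m⊔n≡n (<⇒≤ h<) = refl
bubbleFrom-ins (suc p) h (u ∷ τ) h< (u< ∷ τ<) = cong (h ⊔ u ∷_) (bubbleFrom-ins p (h ⊓ u) τ (≤-<-trans (m⊓n≤m h u) h<) τ<)

-- The effect on the pass of inserting `M` at slot `p` of the word. The pass starts one letter
-- later, so slots shift by one. Slots 0 and 1 coincide: a leading `M` is carried only until the
-- next letter is read.
insBubble : ℕ → ℕ → List ℕ → List ℕ
insBubble zero    M ρ = M ∷ ρ
insBubble (suc p) M ρ = ins p M ρ

bubble-ins : ∀ {M} p x τ → All (_< M) (x ∷ τ) →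
  bubble (ins p M (x ∷ τ)) ≡ insBubble p M (bubble (x ∷ τ))
bubble-ins zero    x τ (x< ∷ τ<) rewrite m≥n⇒m⊔n≡m (<⇒≤ x<) | m≥n⇒m⊓n≡n (<⇒≤ x<) = refl
bubble-ins (suc p) x τ (x< ∷ τ<) = bubbleFrom-ins p x τ x< τ<

-- Products of generators

apply-map : ∀ g τ {k} → InRange (length τ) k → apply (map g τ) k ≡ g (apply τ k)
apply-map g []      {suc k}       (_ , ())
apply-map g (x ∷ τ) {suc zero}    _             = refl
apply-map g (x ∷ τ) {suc (suc k)} (_ , s≤s k≤) = apply-map g τ (s≤s z≤n , k≤)

apply-All : ∀ {P : ℕ → Set} τ {k} → InRange (length τ) k → All P τ → P (apply τ k)
apply-All []      {suc k}       (_ , ())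
apply-All (x ∷ τ) {suc zero}    _            (px ∷ _)  = px
apply-All (x ∷ τ) {suc (suc k)} (_ , s≤s k≤) (_ ∷ pτ) = apply-All τ (s≤s z≤n , k≤) pτ

apply-applyUpTo : ∀ f {N k} → k < N → apply (applyUpTo f N) (suc k) ≡ f k
apply-applyUpTo f {suc N} {zero}  _        = refl
apply-applyUpTo f {suc N} {suc k} (s≤s k<) = apply-applyUpTo (f ∘ suc) k<

-- Outside the positions of `τ`, `apply` returns default values that do not commute with `map`;
-- hence the range condition on `ρ`.
compose-assoc : ∀ σ τ {ρ} → All (InRange (length τ)) ρ →
  compose (compose σ τ) ρ ≡ compose σ (compose τ ρ)
compose-assoc σ τ {ρ} ρ∈ = trans (map-cong-local (All.map (apply-map (apply σ) τ) ρ∈)) (map-∘ ρ)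

compose-identityˡ : ∀ N {ρ} → All (InRange N) ρ → compose (range1 N) ρ ≡ ρ
compose-identityˡ N ρ∈ = map-id-local (All.map fixed ρ∈)
  where
  fixed : ∀ {k} → InRange N k → apply (range1 N) k ≡ k
  fixed {suc k} (_ , k<N) rewrite map-applyUpTo id suc N = apply-applyUpTo suc k<N

compose-InRange : ∀ {N} σ {ρ} → length σ ≡ N → All (InRange N) σ → All (InRange N) ρ → All (InRange N) (compose σ ρ)
compose-InRange σ refl σ∈ ρ∈ = All.map⁺ (All.map (λ k∈ → apply-All σ k∈ σ∈) ρ∈)

range1-InRange : ∀ N → All (InRange N) (range1 N)
range1-InRange N = All.tabulate ∈-range1⁻

applyUpTo-apply : ∀ σ → applyUpTo (λ k → apply σ (suc k)) (length σ) ≡ σ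
applyUpTo-apply []      = refl
applyUpTo-apply (x ∷ σ) = cong (x ∷_) (applyUpTo-apply σ)

transpose : ℕ → ℕ → ℕ
transpose i k = if k ≡ᵇ i then suc i else (if k ≡ᵇ suc i then i else k)

compose-sGen : ∀ {N} i σ → length σ ≡ N → SwapIndex N i → compose σ (sGen N i) ≡ swapAt i σ
compose-sGen i σ refl i∈ = trans (sym (map-∘ (range1 (length σ)))) (trans (map-range1 _ (length σ)) (go i σ i∈))
  where
  go : ∀ i σ → SwapIndex (length σ) i → applyUpTo (λ k → apply σ (transpose i (suc k))) (length σ) ≡ swapAt i σ
  go (suc zero)    (x ∷ [])    (_ , s≤s ())
  go (suc zero)    (x ∷ y ∷ σ) _            = cong (λ ρ → y ∷ x ∷ ρ) (applyUpTo-apply σ)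
  go (suc (suc i)) (x ∷ σ)     (_ , s≤s i<) = cong (x ∷_)
    (trans (applyUpTo-cong shifted (length σ)) (go (suc i) σ (s≤s z≤n , i<)))
    where
    shifted : ∀ k → apply (x ∷ σ) (transpose (suc (suc i)) (suc (suc k))) ≡ apply σ (transpose (suc i) (suc k))
    shifted k with k ≡ᵇ i | k ≡ᵇ suc i
    ... | true  | _     = refl
    ... | false | true  = refl
    ... | false | false = refl

length-sGen : ∀ N i → length (sGen N i) ≡ N
length-sGen N i = trans (length-map _ (range1 N)) (length-range1 N)

within-sGen : ∀ {N} i {ρ} → All (InRange N) ρ → All (InRange (length (sGen N i))) ρ
within-sGen {N} i {ρ} = subst (λ l → All (InRange l) ρ) (sym (length-sGen N i))

sGen-InRange : ∀ {N i} → SwapIndex N i → All (InRange N) (sGen N i)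
sGen-InRange {N} {i} (1≤i , i<N) = All.map⁺ (All.map moved (range1-InRange N))
  where
  moved : ∀ {k} → InRange N k → InRange N (transpose i k)
  moved {k} k∈ with k ≡ᵇ i | k ≡ᵇ suc i
  ... | true  | _     = s≤s z≤n , i<N
  ... | false | true  = 1≤i , <⇒≤ i<N
  ... | false | false = k∈

-- Right multiplication by a word of simple transpositions, letter by letter from the left. It
-- replaces the right-nested products of `prod` by moves on one-line notation.
act : List ℕ → List ℕ → List ℕ
act σ []      = σ
act σ (i ∷ w) = act (swapAt i σ) w

act-++ : ∀ σ v w → act σ (v ++ w) ≡ act (act σ v) w
act-++ σ []      w = refl
act-++ σ (i ∷ v) w = act-++ (swapAt i σ) v w

length-swapAt : ∀ i σ → length (swapAt i σ) ≡ length σ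
length-swapAt i σ = ↭-length (swapAt-↭ i σ)

act-∷ʳ : ∀ τ M w → All (SwapIndex (length τ)) w → act (τ ∷ʳ M) w ≡ act τ w ∷ʳ M
act-∷ʳ τ M []      _         = refl
act-∷ʳ τ M (i ∷ w) (i∈ ∷ w∈) rewrite swapAt-∷ʳ i τ M (proj₂ i∈) =
  act-∷ʳ (swapAt i τ) M w (subst (λ l → All (SwapIndex l) w) (sym (length-swapAt i τ)) w∈)

prodS : ℕ → List ℕ → List ℕ
prodS N w = prod N (map (sGen N) w)

prodS-InRange : ∀ {N} w → All (SwapIndex N) w → All (InRange N) (prodS N w)
prodS-InRange {N} []      _         = range1-InRange N
prodS-InRange {N} (i ∷ w) (i∈ ∷ w∈) =
  compose-InRange (sGen N i) (length-sGen N i) (sGen-InRange i∈) (prodS-InRange w w∈)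

compose-prodS : ∀ {N} σ w → length σ ≡ N → All (SwapIndex N) w → compose σ (prodS N w) ≡ act σ w
compose-prodS σ [] refl _ = trans (map-range1 (apply σ) (length σ)) (applyUpTo-apply σ)
compose-prodS {N} σ (i ∷ w) l (i∈ ∷ w∈) = begin
  compose σ (compose (sGen N i) (prodS N w)) ≡⟨ sym (compose-assoc σ (sGen N i) (within-sGen i (prodS-InRange w w∈))) ⟩
  compose (compose σ (sGen N i)) (prodS N w) ≡⟨ cong (λ ρ → compose ρ (prodS N w)) (compose-sGen i σ l i∈) ⟩
  compose (swapAt i σ) (prodS N w)           ≡⟨ compose-prodS (swapAt i σ) w (trans (length-swapAt i σ) l) w∈ ⟩
  act (swapAt i σ) w                         ∎
  where open ≡-Reasoning

prodS-act : ∀ {N} w → All (SwapIndex N) w → prodS N w ≡ act (range1 N) w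
prodS-act {N} w w∈ = trans (sym (compose-identityˡ N (prodS-InRange w w∈)))
  (compose-prodS (range1 N) w (length-range1 N) w∈)

letterSwaps : LetterA → List ℕ
letterSwaps (a i) = 1 ∷ suc i ∷ []
letterSwaps a1inv = 2 ∷ 1 ∷ []

prodA-prodS : ∀ {N} w → All (SwapIndex N) (concatMap letterSwaps w) →
  prod N (map (evalLetter N) w) ≡ prodS N (concatMap letterSwaps w)
prodA-prodS []          _ = refl
prodA-prodS {N} (a i ∷ w) (i∈ ∷ j∈ ∷ w∈) = trans (cong (compose (aGen N i)) (prodA-prodS w w∈))
  (compose-assoc (sGen N 1) (sGen N (suc i))
    (within-sGen (suc i) (prodS-InRange (concatMap letterSwaps w) w∈)))
prodA-prodS {N} (a1inv ∷ w) (i∈ ∷ j∈ ∷ w∈) = trans (cong (compose (evalLetter N a1inv)) (prodA-prodS w w∈))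
  (compose-assoc (sGen N 2) (sGen N 1)
    (within-sGen 1 (prodS-InRange (concatMap letterSwaps w) w∈)))

compose-aGen : ∀ {N} i σ → length σ ≡ N → 1 ≤ i → suc i < N →
  compose σ (aGen N i) ≡ swapAt (suc i) (swapAt 1 σ)
compose-aGen {N} i σ l 1≤i i<N = begin
  compose σ (compose (sGen N 1) (sGen N (suc i)))
    ≡⟨ sym (compose-assoc σ (sGen N 1) (within-sGen 1 (sGen-InRange (s≤s z≤n , i<N)))) ⟩
  compose (compose σ (sGen N 1)) (sGen N (suc i))
    ≡⟨ cong (λ ρ → compose ρ (sGen N (suc i))) (compose-sGen 1 σ l (≤-refl , ≤-trans (s≤s 1≤i) (<⇒≤ i<N))) ⟩
  compose (swapAt 1 σ) (sGen N (suc i))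
    ≡⟨ compose-sGen (suc i) (swapAt 1 σ) (trans (length-swapAt 1 σ) l) (s≤s z≤n , i<N) ⟩
  swapAt (suc i) (swapAt 1 σ) ∎
  where open ≡-Reasoning

-- The last factor inserts the largest letter

split : ∀ {A : Set} c (τ : List A) → c ≤ length τ → ∃ λ α → ∃ λ γ → τ ≡ α ++ γ × length γ ≡ c
split c []      z≤n = [] , [] , refl , refl
split c (x ∷ τ) c≤ with m≤n⇒m<n∨m≡n c≤
... | inj₂ refl = [] , x ∷ τ , refl , refl
... | inj₁ c<   with α , γ , refl , l ← split c τ (s≤s⁻¹ c<) = x ∷ α , γ , refl , l

-- The transpositions carry `M` to the left across `γ`, one letter at a time. The first one meets
-- the last letter of `γ`, so the induction peels `γ` from the right and collects the crossed
-- letters in `β`.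
act-down-++ : ∀ α γ M β → act (α ++ γ ++ M ∷ β) (down (length α + length γ) (length γ)) ≡ α ++ M ∷ γ ++ β
act-down-++ α γ M β = go γ (reverseView γ) β
  where
  go : ∀ γ → Reverse γ → ∀ β → act (α ++ γ ++ M ∷ β) (down (length α + length γ) (length γ)) ≡ α ++ M ∷ γ ++ β
  go .[] [] β = refl
  go .(γ ∷ʳ x) (γ ∶ rγ ∶ʳ x) β
    rewrite length-++ γ {x ∷ []} | ℕ.+-comm (length γ) 1 | +-suc (length α) (length γ)
    | ++-assoc γ (x ∷ []) (M ∷ β) | ++-assoc γ (x ∷ []) β
    | sym (++-assoc α γ (x ∷ M ∷ β)) | sym (length-++ α {γ})
    | swapAt-++ (α ++ γ) {x} {M} {β} | ++-assoc α γ (M ∷ x ∷ β) | length-++ α {γ} = go γ rγ (x ∷ β)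

act-down : ∀ τ M c → c ≤ length τ → act (τ ∷ʳ M) (down (length τ) c) ≡ ins (length τ ∸ c) M τ
act-down τ M c c≤ with α , γ , refl , refl ← split c τ c≤
  rewrite ++-assoc α γ (M ∷ []) | length-++ α {γ} | m+n∸n≡m (length α) (length γ) =
  trans (act-down-++ α γ M []) (trans (cong (λ δ → α ++ M ∷ δ) (++-identityʳ γ)) (sym (ins-++ α M γ)))

-- The power s₁^c acting on positions, which depends only on the parity of `c`.
twist : ℕ → List ℕ → List ℕ
twist zero          σ = σ
twist (suc zero)    σ = swapAt 1 σ
twist (suc (suc c)) σ = twist c σ

twist-suc : ∀ c σ → twist (suc c) σ ≡ twist c (swapAt 1 σ)
twist-suc zero          σ = refl
twist-suc (suc zero)    σ = sym (swapAt-1-involutive σ)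
twist-suc (suc (suc c)) σ = twist-suc c σ

twist-involutive : ∀ c σ → twist c (twist c σ) ≡ σ
twist-involutive zero          σ = refl
twist-involutive (suc zero)    σ = swapAt-1-involutive σ
twist-involutive (suc (suc c)) σ = twist-involutive c σ

twist-↭ : ∀ c σ → twist c σ ↭ σ
twist-↭ zero          σ = ↭-refl
twist-↭ (suc zero)    σ = swapAt-↭ 1 σ
twist-↭ (suc (suc c)) σ = twist-↭ c σ

twist-++ : ∀ c x y α γ → twist c (x ∷ y ∷ α ++ γ) ≡ twist c (x ∷ y ∷ α) ++ γ
twist-++ zero          x y α γ = refl
twist-++ (suc zero)    x y α γ = refl
twist-++ (suc (suc c)) x y α γ = twist-++ c x y α γ

bubble-twist : ∀ c σ → bubble (twist c σ) ≡ bubble σ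
bubble-twist zero          σ = refl
bubble-twist (suc zero)    σ = bubble-swapAt-1 σ
bubble-twist (suc (suc c)) σ = bubble-twist c σ

twist-parity : ∀ c σ → Unique σ → 2 ≤ length σ →
  isEven (inversions (twist c σ)) ≡ isEven (c + inversions σ)
twist-parity zero          σ u l = refl
twist-parity (suc zero)    σ u l = swapAt-parity 1 σ u (≤-refl , l)
twist-parity (suc (suc c)) σ u l = trans (twist-parity c σ u l) (sym (not-involutive _))

downA : ℕ → ℕ → List ℕ
downA j t = concatMap letterSwaps (map a (down j t))

-- s₁ commutes with s_i for i ≥ 3: the factors s₁ of the letters only twist the
-- first two entries, and what remains inserts M.
act-downA-++ : ∀ x y α γ M β →
  act (x ∷ y ∷ α ++ γ ++ M ∷ β) (downA (suc (length α + length γ)) (length γ)) ≡ twist (length γ) (x ∷ y ∷ α) ++ M ∷ γ ++ β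
act-downA-++ x y α γ M β = go x y γ (reverseView γ) β
  where
  go : ∀ x y γ → Reverse γ → ∀ β → act (x ∷ y ∷ α ++ γ ++ M ∷ β) (downA (suc (length α + length γ)) (length γ)) ≡ twist (length γ) (x ∷ y ∷ α) ++ M ∷ γ ++ β
  go x y .[] [] β = refl
  go x y .(γ ∷ʳ z) (γ ∶ rγ ∶ʳ z) β
    rewrite length-++ γ {z ∷ []} | ℕ.+-comm (length γ) 1 | +-suc (length α) (length γ)
    | ++-assoc γ (z ∷ []) (M ∷ β) | ++-assoc γ (z ∷ []) β
    | sym (++-assoc α γ (z ∷ M ∷ β)) | sym (length-++ α {γ})
    | swapAt-++ (α ++ γ) {z} {M} {β} | ++-assoc α γ (M ∷ z ∷ β) | length-++ α {γ}
    | twist-suc (length γ) (x ∷ y ∷ α) = go y x γ rγ (z ∷ β)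

-- The three shapes of an element of R^A_{m+1}: no letter a₁ or a₁⁻¹, a final a₁, a final a₁⁻¹.
data LastChoice (m : ℕ) : ℕ → Set where
  inner  : ∀ {c} → c ≤ m → LastChoice m c
  full   : LastChoice m (suc m)
  fullⁱⁿᵛ : LastChoice m (suc (suc m))

lastChoice : ∀ {m c} → c ≤ suc (suc m) → LastChoice m c
lastChoice c≤ with m≤n⇒m<n∨m≡n c≤
... | inj₂ refl = fullⁱⁿᵛ
... | inj₁ c<   with m≤n⇒m<n∨m≡n (s≤s⁻¹ c<)
...   | inj₂ refl = full
...   | inj₁ c<′  = inner (s≤s⁻¹ c<′)

down-∷ʳ : ∀ m → down (suc m) (suc m) ≡ down (suc m) m ∷ʳ 1
down-∷ʳ zero    = refl
down-∷ʳ (suc m) = cong (suc (suc m) ∷_) (down-∷ʳ m)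

wordAj-≤ : ∀ {j t} → t ≤ j → wordAj j t ≡ map a (down j t)
wordAj-≤ t≤j rewrite Equivalence.to T-≡ (≤⇒≤ᵇ t≤j) = refl

wordAj-full : ∀ m → wordAj (suc m) (suc m) ≡ map a (down (suc m) m) ∷ʳ a 1
wordAj-full m = trans (wordAj-≤ ≤-refl) (trans (cong (map a) (down-∷ʳ m)) (map-++ a (down (suc m) m) (1 ∷ [])))

wordAj-fullⁱⁿᵛ : ∀ m → wordAj (suc m) (suc (suc m)) ≡ map a (down (suc m) m) ∷ʳ a1inv
wordAj-fullⁱⁿᵛ m rewrite <ᵇ-false (≤-refl {m}) = refl

-- Each letter contributes one s₁, which twists the first two entries, and one step of `M` to the
-- left. A full word first brings `M` directly behind these two entries; then a₁ = s₁s₂ twists once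
-- more and leaves `M` in slot 1, while a₁⁻¹ = s₂s₁ carries it to slot 0 without a further twist.
act-wordAj : ∀ {m} x y τ M → length τ ≡ m → ∀ {c} → LastChoice m c →
  act ((x ∷ y ∷ τ) ∷ʳ M) (concatMap letterSwaps (wordAj (suc m) c)) ≡ ins (suc (suc m) ∸ c) M (twist c (x ∷ y ∷ τ))
act-wordAj x y τ M refl (inner {c} c≤) with α , γ , refl , refl ← split c τ c≤
  rewrite wordAj-≤ {suc (length (α ++ γ))} (m≤n⇒m≤1+n c≤) | ++-assoc α γ (M ∷ []) | length-++ α {γ}
  | m+n∸n≡m (suc (suc (length α))) (length γ) = begin
    act (x ∷ y ∷ α ++ γ ++ M ∷ []) (downA (suc (length α + length γ)) (length γ)) ≡⟨ act-downA-++ x y α γ M [] ⟩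
    twist (length γ) (x ∷ y ∷ α) ++ M ∷ γ ++ []           ≡⟨ cong (λ δ → twist (length γ) (x ∷ y ∷ α) ++ M ∷ δ) (++-identityʳ γ) ⟩
    twist (length γ) (x ∷ y ∷ α) ++ M ∷ γ                 ≡⟨ sym (ins-++ (twist (length γ) (x ∷ y ∷ α)) M γ) ⟩
    ins (length (twist (length γ) (x ∷ y ∷ α))) M (twist (length γ) (x ∷ y ∷ α) ++ γ)
      ≡⟨ cong₂ (λ p ρ → ins p M ρ) (↭-length (twist-↭ (length γ) _)) (sym (twist-++ (length γ) x y α γ)) ⟩
    ins (suc (suc (length α))) M (twist (length γ) (x ∷ y ∷ α ++ γ)) ∎
  where open ≡-Reasoning
act-wordAj x y τ M refl full
  rewrite wordAj-full (length τ) | concatMap-++ letterSwaps (map a (down (suc (length τ)) (length τ))) (a 1 ∷ [])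
  | act-++ (x ∷ y ∷ τ ++ M ∷ []) (downA (suc (length τ)) (length τ)) (1 ∷ 2 ∷ [])
  | act-downA-++ x y [] τ M [] | ++-identityʳ τ | m+n∸n≡m 1 (length τ) = go (length τ) x y
  where
  go : ∀ c x y → swapAt 2 (swapAt 1 (twist c (x ∷ y ∷ []) ++ M ∷ τ)) ≡ ins 1 M (twist (suc c) (x ∷ y ∷ τ))
  go zero          x y = refl
  go (suc zero)    x y = refl
  go (suc (suc c)) x y = go c x y
act-wordAj x y τ M refl fullⁱⁿᵛ
  rewrite wordAj-fullⁱⁿᵛ (length τ) | concatMap-++ letterSwaps (map a (down (suc (length τ)) (length τ))) (a1inv ∷ [])
  | act-++ (x ∷ y ∷ τ ++ M ∷ []) (downA (suc (length τ)) (length τ)) (2 ∷ 1 ∷ [])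
  | act-downA-++ x y [] τ M [] | ++-identityʳ τ | n∸n≡0 (length τ) = go (length τ) x y
  where
  go : ∀ c x y → swapAt 1 (swapAt 2 (twist c (x ∷ y ∷ []) ++ M ∷ τ)) ≡ M ∷ twist c (x ∷ y ∷ τ)
  go zero          x y = refl
  go (suc zero)    x y = refl
  go (suc (suc c)) x y = go c x y

-- Factorizations

-- Choice sequences grown at the right end, the order in which the factors insert ever larger
-- letters. The bound on the choice for factor j is `g j`, with `g = id` in type S and `g = suc` in
-- type A.
data Code (g : ℕ → ℕ) : ℕ → List ℕ → Set where
  []   : Code g 0 []
  snoc : ∀ {m cs c} → Code g m cs → c ≤ g (suc m) → Code g (suc m) (cs ∷ʳ c)

Code-length : ∀ {g m cs} → Code g m cs → length cs ≡ m
Code-length []                   = refl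
Code-length (snoc {cs = cs} k _) = trans (length-++ cs) (trans (ℕ.+-comm (length cs) 1) (cong suc (Code-length k)))

∈-choices⁺ : ∀ {cs bs} → Pointwise _≤_ cs bs → cs ∈ choices bs
∈-choices⁺ []                   = here refl
∈-choices⁺ {c ∷ cs} (c≤ ∷ cs≤) = ∈-concatMap⁺ _
  (Any.map (λ { refl → ∈-map⁺ (c ∷_) (∈-choices⁺ cs≤) }) (∈-upTo⁺ (s≤s c≤)))

∈-choices⁻ : ∀ bs {cs} → cs ∈ choices bs → Pointwise _≤_ cs bs
∈-choices⁻ []       (here refl) = []
∈-choices⁻ (b ∷ bs) cs∈
  with c , c∈ , cs∈′ ← find (∈-concatMap⁻ (λ c → map (c ∷_) (choices bs)) {xs = upTo (suc b)} cs∈)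
  with ds , ds∈ , refl ← ∈-map⁻ (c ∷_) cs∈′ = s≤s⁻¹ (∈-upTo⁻ c∈) ∷ ∈-choices⁻ bs ds∈

map-range1-∷ʳ : ∀ (g : ℕ → ℕ) m → map g (range1 (suc m)) ≡ map g (range1 m) ∷ʳ g (suc m)
map-range1-∷ʳ g m = trans (cong (map g) (range1-∷ʳ m)) (map-++ g (range1 m) (suc m ∷ []))

unsnoc-Pointwise : ∀ {cs} bs {b} → Pointwise _≤_ cs (bs ∷ʳ b) →
  ∃ λ ds → ∃ λ d → cs ≡ ds ∷ʳ d × Pointwise _≤_ ds bs × d ≤ b
unsnoc-Pointwise []       (c≤ ∷ []) = [] , _ , refl , [] , c≤
unsnoc-Pointwise (b ∷ bs) (c≤ ∷ p) with ds , d , refl , q , d≤ ← unsnoc-Pointwise bs p =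
  _ ∷ ds , d , refl , c≤ ∷ q , d≤

Code⇒∈choices : ∀ {g m cs} → Code g m cs → cs ∈ choices (map g (range1 m))
Code⇒∈choices {g} = ∈-choices⁺ ∘ go
  where
  go : ∀ {m cs} → Code g m cs → Pointwise _≤_ cs (map g (range1 m))
  go []                    = []
  go (snoc {m} {cs} {c} k c≤) = subst (Pointwise _≤_ (cs ∷ʳ c)) (sym (map-range1-∷ʳ g m)) (Pointwise.++⁺ (go k) (c≤ ∷ []))

∈choices⇒Code : ∀ g m {cs} → cs ∈ choices (map g (range1 m)) → Code g m cs
∈choices⇒Code g m cs∈ = go m (∈-choices⁻ (map g (range1 m)) cs∈)
  where
  go : ∀ m {cs} → Pointwise _≤_ cs (map g (range1 m)) → Code g m cs
  go zero    [] = []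
  go (suc m) {cs} p
    with ds , d , refl , q , d≤ ← unsnoc-Pointwise (map g (range1 m)) (subst (Pointwise _≤_ cs) (map-range1-∷ʳ g m) p) =
    snoc (go m q) d≤

zipIdx-∷ʳ : ∀ j cs c → zipIdx j (cs ∷ʳ c) ≡ zipIdx j cs ∷ʳ (j + length cs , c)
zipIdx-∷ʳ j []       c = cong (λ k → (k , c) ∷ []) (sym (ℕ.+-identityʳ j))
zipIdx-∷ʳ j (d ∷ cs) c = cong ((j , d) ∷_) (trans (zipIdx-∷ʳ (suc j) cs c)
  (cong (λ k → zipIdx (suc j) cs ∷ʳ (k , c)) (sym (+-suc j (length cs)))))

zipIdx-Code : ∀ {g m cs} c → Code g m cs → zipIdx 1 (cs ∷ʳ c) ≡ zipIdx 1 cs ∷ʳ (suc m , c)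
zipIdx-Code {cs = cs} c k = trans (zipIdx-∷ʳ 1 cs c) (cong (λ l → zipIdx 1 cs ∷ʳ (suc l , c)) (Code-length k))

concatMap-∷ʳ : ∀ {A B : Set} (f : A → List B) xs x → concatMap f (xs ∷ʳ x) ≡ concatMap f xs ++ f x
concatMap-∷ʳ f xs x = trans (concatMap-++ f xs (x ∷ [])) (cong (concatMap f xs ++_) (++-identityʳ (f x)))

count-++ : ∀ {A : Set} (p : A → Bool) xs ys → count p (xs ++ ys) ≡ count p xs + count p ys
count-++ p xs ys = trans (cong length (filter-++ (T? ∘ p) xs ys)) (length-++ (filterᵇ p xs))

findFirst-just : ∀ {A : Set} (p : A → Bool) xs {x} → x ∈ xs → p x ≡ true →
  ∃ λ y → findFirst p xs ≡ just y × y ∈ xs × p y ≡ true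
findFirst-just p (z ∷ xs) x∈ px with p z in eq
... | true = z , refl , here refl , eq
findFirst-just p (z ∷ xs) (here refl) px | false with () ← trans (sym px) eq
findFirst-just p (z ∷ xs) (there x∈)  px | false with y , e , y∈ , py ← findFirst-just p xs x∈ px =
  y , e , there y∈ , py

listEq-refl : ∀ σ → listEq σ σ ≡ true
listEq-refl []      = refl
listEq-refl (x ∷ σ) rewrite Equivalence.to T-≡ (≡⇒≡ᵇ x x refl) = listEq-refl σ

listEq-sound : ∀ σ τ → listEq σ τ ≡ true → σ ≡ τ
listEq-sound []      []      _ = refl
listEq-sound (x ∷ σ) (y ∷ τ) e with x ≡ᵇ y in eq
... | true = cong₂ _∷_ (≡ᵇ⇒≡ x y (Equivalence.from T-≡ eq)) (listEq-sound σ τ e)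

-- The search may return a sequence `ds` other than `cs`. It evaluates to the same permutation, so
-- statistics expressed through the value of a code carry over to it.
find-eval : ∀ (eval : List ℕ → List ℕ) g m {cs σ} → Code g m cs → eval cs ≡ σ →
  ∃ λ ds → findFirst (λ cs → listEq (eval cs) σ) (choices (map g (range1 m))) ≡ just ds × Code g m ds × eval ds ≡ σ
find-eval eval g m {cs} k refl
  with ds , e , ds∈ , eq ← findFirst-just (λ ds → listEq (eval ds) (eval cs)) _ (Code⇒∈choices k) (listEq-refl (eval cs)) =
  ds , e , ∈choices⇒Code g m ds∈ , listEq-sound (eval ds) (eval cs) eq

-- Factorizations in type S

down-All : ∀ j t → t ≤ j → All (InRange j) (down j t)
down-All j       zero    _         = []
down-All (suc j) (suc t) (s≤s t≤j) = (s≤s z≤n , ≤-refl) ∷ All.map (λ (p , q) → p , m≤n⇒m≤1+n q) (down-All j t t≤j)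

wordS-∷ʳ : ∀ {m cs} c → Code id m cs → wordS (cs ∷ʳ c) ≡ wordS cs ++ down (suc m) c
wordS-∷ʳ {cs = cs} c k = trans (cong (concatMap _) (zipIdx-Code c k)) (concatMap-∷ʳ _ (zipIdx 1 cs) _)

wordS-SwapIndex : ∀ {m cs} → Code id m cs → All (SwapIndex (suc m)) (wordS cs)
wordS-SwapIndex [] = []
wordS-SwapIndex (snoc {m} {cs} {c} k c≤) = subst (All _) (sym (wordS-∷ʳ c k))
  (All.++⁺ (All.map (λ (p , q) → p , m≤n⇒m≤1+n q) (wordS-SwapIndex k))
           (All.map (λ (p , q) → p , s≤s q) (down-All (suc m) c c≤)))

range1-perm : ∀ N → IsPerm N (range1 N)
range1-perm N = isPerm (length-range1 N) (range1-InRange N) (Unique.map⁺ suc-injective (Unique.upTo⁺ N))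

IsPerm-act : ∀ {N} w σ → IsPerm N σ → IsPerm N (act σ w)
IsPerm-act []      σ s = s
IsPerm-act (i ∷ w) σ s = IsPerm-act w (swapAt i σ) (IsPerm-resp-↭ (↭-sym (swapAt-↭ i σ)) s)

evalS-act : ∀ {m cs} → Code id m cs → evalS (suc m) cs ≡ act (range1 (suc m)) (wordS cs)
evalS-act k = prodS-act _ (wordS-SwapIndex k)

evalS-perm : ∀ {m cs} → Code id m cs → IsPerm (suc m) (evalS (suc m) cs)
evalS-perm {m} {cs} k = subst (IsPerm (suc m)) (sym (evalS-act k)) (IsPerm-act (wordS cs) _ (range1-perm (suc m)))

-- The earlier factors do not touch the last position, so the new largest letter waits at the end
-- until the last factor carries it `c` places to the left.
evalS-snoc : ∀ {m cs c} → Code id m cs → c ≤ suc m →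
  evalS (suc (suc m)) (cs ∷ʳ c) ≡ ins (suc m ∸ c) (suc (suc m)) (evalS (suc m) cs)
evalS-snoc {m} {cs} {c} k c≤ = begin
  evalS N (cs ∷ʳ c)                               ≡⟨ evalS-act (snoc k c≤) ⟩
  act (range1 N) (wordS (cs ∷ʳ c))                ≡⟨ cong₂ act (range1-∷ʳ (suc m)) (wordS-∷ʳ c k) ⟩
  act (range1 (suc m) ∷ʳ N) (wordS cs ++ down (suc m) c) ≡⟨ act-++ _ (wordS cs) _ ⟩
  act (act (range1 (suc m) ∷ʳ N) (wordS cs)) (down (suc m) c)
    ≡⟨ cong (λ ρ → act ρ (down (suc m) c)) (act-∷ʳ (range1 (suc m)) N (wordS cs)
         (subst (λ l → All (SwapIndex l) (wordS cs)) (sym (length-range1 (suc m))) (wordS-SwapIndex k))) ⟩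
  act (act (range1 (suc m)) (wordS cs) ∷ʳ N) (down (suc m) c) ≡⟨ cong (λ ρ → act (ρ ∷ʳ N) (down (suc m) c)) (sym (evalS-act k)) ⟩
  act (e ∷ʳ N) (down (suc m) c)                   ≡⟨ cong (λ l → act (e ∷ʳ N) (down l c)) (sym (len (evalS-perm k))) ⟩
  act (e ∷ʳ N) (down (length e) c)                ≡⟨ act-down e N c (subst (c ≤_) (sym (len (evalS-perm k))) c≤) ⟩
  ins (length e ∸ c) N e                          ≡⟨ cong (λ l → ins (l ∸ c) N e) (len (evalS-perm k)) ⟩
  ins (suc m ∸ c) N e                             ∎
  where
  open ≡-Reasoning
  N = suc (suc m)
  e = evalS (suc m) cs

evalS-surjective : ∀ m {σ} → IsPerm (suc m) σ → ∃ λ cs → Code id m cs × evalS (suc m) cs ≡ σ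
evalS-surjective zero {x ∷ []} (isPerm _ ((s≤s z≤n , s≤s z≤n) ∷ []) _) = [] , [] , refl
evalS-surjective (suc m) s with τ , p , sτ , p≤ , refl ← perm-uninsert s
  with cs , k , refl ← evalS-surjective m sτ =
  -- The last choice is the number of letters to the right of the largest one.
  cs ∷ʳ (suc m ∸ p) , snoc k (m∸n≤m (suc m) p) ,
  trans (evalS-snoc k (m∸n≤m (suc m) p)) (cong (λ q → ins q (suc (suc m)) (evalS (suc m) cs)) (m∸[m∸n]≡n p≤))

fullFactor : ℕ × ℕ → Bool
fullFactor p = proj₁ p ≡ᵇ proj₂ p

-- The last factor is full exactly when it puts the largest letter in front, and this is the only
-- slot that creates a left-to-right minimum beyond the first entry.
evalS-del : ∀ {m cs} → Code id m cs → count fullFactor (zipIdx 1 cs) ≡ del (evalS (suc m) cs)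
evalS-del [] = refl
evalS-del (snoc {m} {cs} {c} k c≤) = begin
  count fullFactor (zipIdx 1 (cs ∷ʳ c))                         ≡⟨ cong (count fullFactor) (zipIdx-Code c k) ⟩
  count fullFactor (zipIdx 1 cs ∷ʳ (suc m , c))                 ≡⟨ count-++ fullFactor (zipIdx 1 cs) _ ⟩
  count fullFactor (zipIdx 1 cs) + count fullFactor ((suc m , c) ∷ []) ≡⟨ cong (_+ count fullFactor ((suc m , c) ∷ [])) (evalS-del k) ⟩
  del e + count fullFactor ((suc m , c) ∷ [])                   ≡⟨ step e (evalS-perm k) (m≤n⇒m<n∨m≡n c≤) ⟩
  del (ins (suc m ∸ c) (suc (suc m)) e)                         ≡⟨ cong del (sym (evalS-snoc k c≤)) ⟩
  del (evalS (suc (suc m)) (cs ∷ʳ c))                           ∎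
  where
  open ≡-Reasoning
  e = evalS (suc m) cs
  step : ∀ e → IsPerm (suc m) e → c < suc m ⊎ c ≡ suc m →
    del e + count fullFactor ((suc m , c) ∷ []) ≡ del (ins (suc m ∸ c) (suc (suc m)) e)
  step (x ∷ τ) s (inj₂ refl) rewrite n∸n≡0 m | Equivalence.to T-≡ (≡⇒≡ᵇ m m refl)
    | ins-zero-del {suc (suc m)} x τ (All.head (perm-below s)) = ℕ.+-comm (del (x ∷ τ)) 1
  step (x ∷ τ) s (inj₁ c<) rewrite +-∸-assoc 1 (s≤s⁻¹ c<)
    | ins-suc-del (m ∸ c) x τ (perm-below s) with suc m ≡ᵇ c in eq
  ... | false = ℕ.+-identityʳ _
  ... | true  = contradiction (≡ᵇ⇒≡ (suc m) c (Equivalence.from T-≡ eq)) (>⇒≢ c<)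

delS-del : ∀ {m σ} → IsPerm (suc m) σ → delS (suc m) σ ≡ del σ
delS-del {m} s with cs , k , refl ← evalS-surjective m s
  with ds , e , kds , eq ← find-eval (evalS (suc m)) id m k refl
  rewrite map-id (range1 m) | e = trans (evalS-del kds) (cong del eq)

-- Factorizations in type A

wordA-∷ʳ : ∀ {m cs} c → Code suc m cs → wordA (cs ∷ʳ c) ≡ wordA cs ++ wordAj (suc m) c
wordA-∷ʳ {cs = cs} c k = trans (cong (concatMap _) (zipIdx-Code c k)) (concatMap-∷ʳ _ (zipIdx 1 cs) _)

downA-SwapIndex : ∀ m t → t ≤ suc m → All (SwapIndex (suc (suc (suc m)))) (downA (suc m) t)
downA-SwapIndex m t t≤ = go (down-All (suc m) t t≤)
  where
  go : ∀ {is} → All (InRange (suc m)) is → All (SwapIndex (suc (suc (suc m)))) (concatMap letterSwaps (map a is))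
  go []                = []
  go ((p , q) ∷ is∈) = (≤-refl , s≤s (s≤s z≤n)) ∷ (s≤s z≤n , s≤s (s≤s q)) ∷ go is∈

wordAj-SwapIndex : ∀ {m c} → LastChoice m c → All (SwapIndex (suc (suc (suc m)))) (concatMap letterSwaps (wordAj (suc m) c))
wordAj-SwapIndex {m} {c} (inner c≤) rewrite wordAj-≤ {suc m} (m≤n⇒m≤1+n c≤) = downA-SwapIndex m c (m≤n⇒m≤1+n c≤)
wordAj-SwapIndex {m} full rewrite wordAj-≤ {suc m} ≤-refl = downA-SwapIndex m (suc m) ≤-refl
wordAj-SwapIndex {m} fullⁱⁿᵛ rewrite wordAj-fullⁱⁿᵛ m | concatMap-∷ʳ letterSwaps (map a (down (suc m) m)) a1inv =
  All.++⁺ (downA-SwapIndex m m (n≤1+n m)) ((s≤s z≤n , s≤s (s≤s (s≤s z≤n))) ∷ (≤-refl , s≤s (s≤s z≤n)) ∷ [])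

swapsA : List ℕ → List ℕ
swapsA cs = concatMap letterSwaps (wordA cs)

swapsA-∷ʳ : ∀ {m cs} c → Code suc m cs → swapsA (cs ∷ʳ c) ≡ swapsA cs ++ concatMap letterSwaps (wordAj (suc m) c)
swapsA-∷ʳ {cs = cs} c k = trans (cong (concatMap letterSwaps) (wordA-∷ʳ c k)) (concatMap-++ letterSwaps (wordA cs) _)

swapsA-SwapIndex : ∀ {m cs} → Code suc m cs → All (SwapIndex (suc (suc m))) (swapsA cs)
swapsA-SwapIndex [] = []
swapsA-SwapIndex (snoc {m} {cs} {c} k c≤) = subst (All _) (sym (swapsA-∷ʳ c k))
  (All.++⁺ (All.map (λ (p , q) → p , m≤n⇒m≤1+n q) (swapsA-SwapIndex k)) (wordAj-SwapIndex (lastChoice c≤)))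

evalA-act : ∀ {m cs} → Code suc m cs → evalA (suc m) cs ≡ act (range1 (suc (suc m))) (swapsA cs)
evalA-act {cs = cs} k = trans (prodA-prodS (wordA cs) (swapsA-SwapIndex k)) (prodS-act _ (swapsA-SwapIndex k))

evalA-perm : ∀ {m cs} → Code suc m cs → IsPerm (suc (suc m)) (evalA (suc m) cs)
evalA-perm {m} {cs} k = subst (IsPerm (suc (suc m))) (sym (evalA-act k)) (IsPerm-act (swapsA cs) _ (range1-perm (suc (suc m))))

-- As in type S, except that the `c` choices of s₁ hidden in the last factor also twist the word
-- already built. For the longest word, `twist` by `suc (suc m)` equals the `m` twists that occur.
evalA-snoc : ∀ {m cs c} → Code suc m cs → c ≤ suc (suc m) →
  evalA (suc (suc m)) (cs ∷ʳ c) ≡ ins (suc (suc m) ∸ c) (suc (suc (suc m))) (twist c (evalA (suc m) cs))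
evalA-snoc {m} {cs} {c} k c≤ = begin
  evalA (suc (suc m)) (cs ∷ʳ c)          ≡⟨ evalA-act (snoc k c≤) ⟩
  act (range1 N) (swapsA (cs ∷ʳ c))      ≡⟨ cong₂ act (range1-∷ʳ (suc (suc m))) (swapsA-∷ʳ c k) ⟩
  act (range1 (suc (suc m)) ∷ʳ N) (swapsA cs ++ w) ≡⟨ act-++ _ (swapsA cs) _ ⟩
  act (act (range1 (suc (suc m)) ∷ʳ N) (swapsA cs)) w
    ≡⟨ cong (λ ρ → act ρ w) (act-∷ʳ (range1 (suc (suc m))) N (swapsA cs)
         (subst (λ l → All (SwapIndex l) (swapsA cs)) (sym (length-range1 (suc (suc m)))) (swapsA-SwapIndex k))) ⟩
  act (act (range1 (suc (suc m))) (swapsA cs) ∷ʳ N) w ≡⟨ cong (λ ρ → act (ρ ∷ʳ N) w) (sym (evalA-act k)) ⟩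
  act (evalA (suc m) cs ∷ʳ N) w          ≡⟨ step (evalA (suc m) cs) (len (evalA-perm k)) ⟩
  ins (suc (suc m) ∸ c) N (twist c (evalA (suc m) cs)) ∎
  where
  open ≡-Reasoning
  N = suc (suc (suc m))
  w = concatMap letterSwaps (wordAj (suc m) c)
  step : ∀ e → length e ≡ suc (suc m) → act (e ∷ʳ N) w ≡ ins (suc (suc m) ∸ c) N (twist c e)
  step (x ∷ y ∷ τ) l = act-wordAj x y τ N (suc-injective (suc-injective l)) (lastChoice c≤)

-- The induction removes the largest letter as in type S, but what remains may be odd and must be
-- corrected by a twist. For two letters the only even word is the identity.
evalA-surjective : ∀ m {σ} → IsPerm (suc (suc m)) σ → isEven (inversions σ) ≡ true →
  ∃ λ cs → Code suc m cs × evalA (suc m) cs ≡ σ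
evalA-surjective zero {x ∷ y ∷ []} (isPerm _ ((s≤s z≤n , x≤) ∷ (s≤s z≤n , y≤) ∷ []) ((x≢y ∷ []) ∷ _)) even = two x≤ y≤ x≢y even
  where
  two : ∀ {x y} → suc x ≤ 2 → suc y ≤ 2 → suc x ≢ suc y → isEven (inversions (suc x ∷ suc y ∷ [])) ≡ true →
    ∃ λ cs → Code suc 0 cs × evalA 1 cs ≡ suc x ∷ suc y ∷ []
  two {zero}        {zero}        _ _ ≢ _ = contradiction refl ≢
  two {zero}        {suc zero}    _ _ _ _ = [] , [] , refl
  two {suc zero}    {suc zero}    _ _ ≢ _ = contradiction refl ≢
  two {suc zero}    {zero}        _ _ _ ()
  two {suc (suc _)} {_}           (s≤s (s≤s ())) _ _ _
  two {_}           {suc (suc _)} _ (s≤s (s≤s ())) _ _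
evalA-surjective (suc m) s even with τ , p , sτ , p≤ , refl ← perm-uninsert s
  -- The removed letter accounted for `suc (suc m) ∸ p` inversions. Since `σ` is even, `τ` has the
  -- parity of this number, and twisting `τ` that many times makes it even.
  with cs , k , eq ← evalA-surjective m {twist (suc (suc m) ∸ p) τ} (IsPerm-resp-↭ (↭-sym (twist-↭ (suc (suc m) ∸ p) τ)) sτ)
    (trans (twist-parity (suc (suc m) ∸ p) τ (unique sτ) (subst (2 ≤_) (sym (len sτ)) (s≤s (s≤s z≤n))))
      (trans (cong isEven (trans (cong (λ l → l ∸ p + inversions τ) (sym (len sτ)))
        (sym (inversions-ins p τ (perm-below sτ) (subst (p ≤_) (sym (len sτ)) p≤))))) even)) =
  cs ∷ʳ c , snoc k c≤ , trans (evalA-snoc k c≤)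
    (cong₂ (λ q ρ → ins q (suc (suc (suc m))) ρ) (m∸[m∸n]≡n p≤) (trans (cong (twist c) eq) (twist-involutive c τ)))
  where
  c = suc (suc m) ∸ p
  c≤ : c ≤ suc (suc m)
  c≤ = m∸n≤m (suc (suc m)) p

length-down : ∀ j t → length (down j t) ≡ t
length-down j zero    = refl
length-down j (suc t) = cong suc (length-down (j ∸ 1) t)

count-isA1-down : ∀ m t → t ≤ m → count isA1 (map a (down (suc m) t)) ≡ 0
count-isA1-down m t t≤ = cong length (filter-none (T? ∘ isA1) (All.map⁺ (go m t t≤)))
  where
  go : ∀ m t → t ≤ m → All (λ i → ¬ T (i ≡ᵇ 1)) (down (suc m) t)
  go m       zero    _         = []
  go (suc m) (suc t) (s≤s t≤m) = id ∷ go m t t≤m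

-- For `c ≤ m` the word has `c` letters and `M` lands in the pass with `c` letters to its right, not
-- in front. Both full words have `suc m` letters, exactly one of them a₁ or a₁⁻¹, and put `M` in
-- front of the pass.
wordAj-stats : ∀ {m c} → LastChoice m c → ∀ {M} ρ → length ρ ≡ suc m → All (_< M) ρ →
  let ρ′ = insBubble (suc (suc m) ∸ c) M ρ in
  inversions ρ + length (wordAj (suc m) c) ≡ inversions ρ′ × del ρ + count isA1 (wordAj (suc m) c) ≡ del ρ′
wordAj-stats {m} (inner {c} c≤) {M} (x ∷ τ) l τ<
  rewrite wordAj-≤ {suc m} (m≤n⇒m≤1+n c≤) | length-map a (down (suc m) c) | length-down (suc m) c
  | count-isA1-down m c c≤ | +-∸-assoc 2 c≤ | ins-suc-del (m ∸ c) x τ τ<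
  | inversions-ins (suc (m ∸ c)) (x ∷ τ) τ< (subst (suc (m ∸ c) ≤_) (sym l) (s≤s (m∸n≤m m c)))
  | suc-injective l | m∸[m∸n]≡n c≤ = ℕ.+-comm _ c , ℕ.+-identityʳ _
wordAj-stats {m} full {M} (x ∷ τ) l τ<
  rewrite wordAj-full m | length-++ (map a (down (suc m) m)) {a 1 ∷ []} | count-++ isA1 (map a (down (suc m) m)) (a 1 ∷ [])
  | length-map a (down (suc m) m) | length-down (suc m) m | count-isA1-down m m ≤-refl
  | m+n∸n≡m 1 m | ins-zero-del {M} x τ (All.head τ<) | smaller-all (x ∷ τ) τ< | suc-injective l | ℕ.+-comm m 1
  = ℕ.+-comm _ (suc m) , ℕ.+-comm _ 1
wordAj-stats {m} fullⁱⁿᵛ {M} (x ∷ τ) l τ<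
  rewrite wordAj-fullⁱⁿᵛ m | length-++ (map a (down (suc m) m)) {a1inv ∷ []} | count-++ isA1 (map a (down (suc m) m)) (a1inv ∷ [])
  | length-map a (down (suc m) m) | length-down (suc m) m | count-isA1-down m m ≤-refl
  | n∸n≡0 m | ins-zero-del {M} x τ (All.head τ<) | smaller-all (x ∷ τ) τ< | suc-injective l | ℕ.+-comm m 1
  = ℕ.+-comm _ (suc m) , ℕ.+-comm _ 1

length-bubble : ∀ {N} σ → length σ ≡ suc N → length (bubble σ) ≡ N
length-bubble (x ∷ σ) l = trans (length-bubbleFrom x σ) (suc-injective l)

-- A twist of the first two entries is invisible to the pass, so an appended factor acts on the pass
-- as a mere insertion.
evalA-stats : ∀ {m cs} → Code suc m cs →
  length (wordA cs) ≡ inversions (bubble (evalA (suc m) cs)) × count isA1 (wordA cs) ≡ del (bubble (evalA (suc m) cs))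
evalA-stats [] = refl , refl
evalA-stats (snoc {m} {cs} {c} k c≤)
  with ih₁ , ih₂ ← evalA-stats k
  with st₁ , st₂ ← wordAj-stats (lastChoice c≤) {suc (suc (suc m))} (bubble (evalA (suc m) cs))
         (length-bubble (evalA (suc m) cs) (len (evalA-perm k))) (bubble-All (evalA (suc m) cs) (perm-below (evalA-perm k))) =
  trans (cong length (wordA-∷ʳ c k)) (trans (length-++ (wordA cs)) (trans (cong (_+ _) ih₁) (trans st₁ (sym (cong inversions pass))))) ,
  trans (cong (count isA1) (wordA-∷ʳ c k)) (trans (count-++ isA1 (wordA cs) _) (trans (cong (_+ _) ih₂) (trans st₂ (sym (cong del pass)))))
  where
  open ≡-Reasoning
  e = evalA (suc m) cs
  ins-pass : ∀ {N M} p e → length e ≡ suc N → All (_< M) e → bubble (ins p M e) ≡ insBubble p M (bubble e)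
  ins-pass p (x ∷ τ) _ = bubble-ins p x τ
  pass : bubble (evalA (suc (suc m)) (cs ∷ʳ c)) ≡ insBubble (suc (suc m) ∸ c) (suc (suc (suc m))) (bubble e)
  pass = begin
    bubble (evalA (suc (suc m)) (cs ∷ʳ c)) ≡⟨ cong bubble (evalA-snoc k c≤) ⟩
    bubble (ins (suc (suc m) ∸ c) _ (twist c e))
      ≡⟨ ins-pass (suc (suc m) ∸ c) (twist c e) (trans (↭-length (twist-↭ c e)) (len (evalA-perm k)))
           (All-resp-↭ (↭-sym (twist-↭ c e)) (perm-below (evalA-perm k))) ⟩
    insBubble (suc (suc m) ∸ c) _ (bubble (twist c e)) ≡⟨ cong (insBubble (suc (suc m) ∸ c) _) (bubble-twist c e) ⟩
    insBubble (suc (suc m) ∸ c) _ (bubble e) ∎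

factorA-stats : ∀ {m σ} → IsPerm (suc (suc m)) σ → isEven (inversions σ) ≡ true →
  lenA (suc m) σ ≡ inversions (bubble σ) × delA (suc m) σ ≡ del (bubble σ)
factorA-stats {m} s even with cs , k , refl ← evalA-surjective m s even
  with ds , e , kds , eq ← find-eval (evalA (suc m)) suc m k refl
  with st₁ , st₂ ← evalA-stats kds
  rewrite e = trans st₁ (cong (inversions ∘ bubble) eq) , trans st₂ (cong (del ∘ bubble) eq)

-- Since a_i = s₁s_{i+1} and s₁ is invisible to the pass, comparing lengths for `i` means exchanging
-- positions `i + 1` and `i + 2` of the word, which are positions `i` and `i + 1` of the pass.
rmajA-rmaj : ∀ {m σ} → IsPerm (suc (suc m)) σ → isEven (inversions σ) ≡ true →
  rmajA (suc m) σ ≡ rmaj (bubble σ)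
rmajA-rmaj {m} {σ} s even = trans
  (cong sum (map-cong-local (All.map (λ {i} i∈ → cong (λ b → if b then suc m ∸ i else 0) (descent i∈)) (range1-InRange m))))
  (trans (cong (λ n → rmajS n (bubble σ)) (sym l)) (rmajS-rmaj (bubble σ)))
  where
  l : length (bubble σ) ≡ suc m
  l = length-bubble σ (len s)
  σ′ = swapAt 1 σ
  s′ : IsPerm (suc (suc m)) σ′
  s′ = IsPerm-resp-↭ (↭-sym (swapAt-↭ 1 σ)) s
  descent : ∀ {i} → InRange m i → (lenA (suc m) (compose σ (aGen (suc (suc m)) i)) ≤ᵇ lenA (suc m) σ) ≡ isDescent i (bubble σ)
  descent {i} (1≤i , i≤m) = begin
    (lenA (suc m) (compose σ (aGen (suc (suc m)) i)) ≤ᵇ lenA (suc m) σ)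
      ≡⟨ cong₂ _≤ᵇ_ (cong (lenA (suc m)) (compose-aGen i σ (len s) 1≤i (s≤s (s≤s i≤m)))) (proj₁ (factorA-stats s even)) ⟩
    (lenA (suc m) (swapAt (suc i) σ′) ≤ᵇ inversions (bubble σ))
      ≡⟨ cong (_≤ᵇ inversions (bubble σ)) (proj₁ (factorA-stats (IsPerm-resp-↭ (↭-sym (swapAt-↭ (suc i) σ′)) s′) even″)) ⟩
    (inversions (bubble (swapAt (suc i) σ′)) ≤ᵇ inversions (bubble σ))
      ≡⟨ cong (λ ρ → inversions (bubble (swapAt (suc i) σ′)) ≤ᵇ inversions ρ) (sym (bubble-swapAt-1 σ)) ⟩
    (inversions (bubble (swapAt (suc i) σ′)) ≤ᵇ inversions (bubble σ′))
      ≡⟨ bubble-descent i σ′ (unique s′) 1≤i (subst (suc i <_) (sym (len s′)) (s≤s (s≤s i≤m))) ⟩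
    isDescent i (bubble σ′) ≡⟨ cong (isDescent i) (bubble-swapAt-1 σ) ⟩
    isDescent i (bubble σ)  ∎
    where
    open ≡-Reasoning
    -- `factorA-stats` speaks of even words only; the two exchanges in a_i preserve the parity.
    even″ : isEven (inversions (swapAt (suc i) σ′)) ≡ true
    even″ = trans (swapAt-parity (suc i) σ′ (unique s′) (s≤s z≤n , subst (suc i <_) (sym (len s′)) (s≤s (s≤s i≤m))))
      (trans (cong not (swapAt-parity 1 σ (unique s) (≤-refl , subst (1 <_) (sym (len s)) (s≤s (s≤s z≤n)))))
        (trans (not-involutive _) even))

-- Generating functions

module GeneratingFunctions {c ℓ} (R : CommutativeSemiring c ℓ) (q : CommutativeSemiring.Carrier R) where
  open CommutativeSemiring R hiding (zero) renaming (_+_ to _⊕_; _*_ to _⊛_; refl to ≈-refl; sym to ≈-sym; trans to ≈-trans; setoid to ≈-setoid)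
  open import Algebra.Properties.CommutativeSemigroup +-commutativeSemigroup using (interchange; x∙yz≈y∙xz)
  open import Algebra.Properties.CommutativeSemigroup *-commutativeSemigroup using () renaming (x∙yz≈y∙xz to x*yz≈y*xz)
  open Relation.Binary.Reasoning.Setoid ≈-setoid

  ∑ : ∀ {A : Set} → List A → (A → Carrier) → Carrier
  ∑ xs F = foldr (λ x acc → F x ⊕ acc) 0# xs

  infix 8 _⟦_⟧

  -- An Iverson bracket as a factor, which moves the conditions of `filterᵇ` into the summands.
  _⟦_⟧ : Bool → Carrier → Carrier
  b ⟦ x ⟧ = if b then x else 0#

  guard-cong : ∀ b {x y} → (b ≡ true → x ≈ y) → b ⟦ x ⟧ ≈ b ⟦ y ⟧
  guard-cong true  e = e refl
  guard-cong false e = ≈-refl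

  guard-≡ : ∀ {b b′} x → b ≡ b′ → b ⟦ x ⟧ ≈ b′ ⟦ x ⟧
  guard-≡ x refl = ≈-refl

  guard-⊕ : ∀ b x y → b ⟦ x ⊕ y ⟧ ≈ b ⟦ x ⟧ ⊕ b ⟦ y ⟧
  guard-⊕ true  x y = ≈-refl
  guard-⊕ false x y = ≈-sym (+-identityˡ 0#)

  guard-⊛ : ∀ b u x → b ⟦ u ⊛ x ⟧ ≈ u ⊛ b ⟦ x ⟧
  guard-⊛ true  u x = ≈-refl
  guard-⊛ false u x = ≈-sym (zeroʳ u)

  ∑-cong : ∀ {A : Set} (xs : List A) {F G : A → Carrier} → (∀ {x} → x ∈ xs → F x ≈ G x) → ∑ xs F ≈ ∑ xs G
  ∑-cong []       e = ≈-refl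
  ∑-cong (x ∷ xs) e = +-cong (e (here refl)) (∑-cong xs (e ∘ there))

  ∑-++ : ∀ {A : Set} (xs ys : List A) F → ∑ (xs ++ ys) F ≈ ∑ xs F ⊕ ∑ ys F
  ∑-++ []       ys F = ≈-sym (+-identityˡ _)
  ∑-++ (x ∷ xs) ys F = ≈-trans (+-congˡ (∑-++ xs ys F)) (≈-sym (+-assoc _ _ _))

  ∑-map : ∀ {A B : Set} (g : A → B) xs F → ∑ (map g xs) F ≈ ∑ xs (F ∘ g)
  ∑-map g []       F = ≈-refl
  ∑-map g (x ∷ xs) F = +-congˡ (∑-map g xs F)

  ∑-concatMap : ∀ {A B : Set} (h : A → List B) xs F → ∑ (concatMap h xs) F ≈ ∑ xs (λ x → ∑ (h x) F)
  ∑-concatMap h []       F = ≈-refl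
  ∑-concatMap h (x ∷ xs) F = ≈-trans (∑-++ (h x) (concatMap h xs) F) (+-congˡ (∑-concatMap h xs F))

  ∑-↭ : ∀ {A : Set} {xs ys : List A} F → xs ↭ ys → ∑ xs F ≈ ∑ ys F
  ∑-↭ F _↭_.refl          = ≈-refl
  ∑-↭ F (_↭_.prep x p)    = +-congˡ (∑-↭ F p)
  ∑-↭ F (_↭_.swap x y p)  = ≈-trans (x∙yz≈y∙xz _ _ _) (+-congˡ (+-congˡ (∑-↭ F p)))
  ∑-↭ F (_↭_.trans p p′) = ≈-trans (∑-↭ F p) (∑-↭ F p′)

  ∑-filter : ∀ {A : Set} (p : A → Bool) xs F → ∑ (filterᵇ p xs) F ≈ ∑ xs (λ x → p x ⟦ F x ⟧)
  ∑-filter p []       F = ≈-refl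
  ∑-filter p (x ∷ xs) F with p x
  ... | true  = +-congˡ (∑-filter p xs F)
  ... | false = ≈-trans (∑-filter p xs F) (≈-sym (+-identityˡ _))

  ∑-⊕ : ∀ {A : Set} (xs : List A) F G → ∑ xs (λ x → F x ⊕ G x) ≈ ∑ xs F ⊕ ∑ xs G
  ∑-⊕ []       F G = ≈-sym (+-identityˡ 0#)
  ∑-⊕ (x ∷ xs) F G = ≈-trans (+-congˡ (∑-⊕ xs F G)) (interchange _ _ _ _)

  ∑-⊛ : ∀ {A : Set} u (xs : List A) F → ∑ xs (λ x → u ⊛ F x) ≈ u ⊛ ∑ xs F
  ∑-⊛ u []       F = ≈-sym (zeroʳ u)
  ∑-⊛ u (x ∷ xs) F = ≈-trans (+-congˡ (∑-⊛ u xs F)) (≈-sym (distribˡ u _ _))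

  ∑-0# : ∀ {A : Set} (xs : List A) → ∑ xs (λ _ → 0#) ≈ 0#
  ∑-0# []       = ≈-refl
  ∑-0# (x ∷ xs) = ≈-trans (+-identityˡ _) (∑-0# xs)

  ∑-swap : ∀ {A B : Set} (xs : List A) (ys : List B) (F : A → B → Carrier) → ∑ xs (λ x → ∑ ys (F x)) ≈ ∑ ys (λ y → ∑ xs (λ x → F x y))
  ∑-swap []       ys F = ≈-sym (∑-0# ys)
  ∑-swap (x ∷ xs) ys F = ≈-trans (+-congˡ (∑-swap xs ys F)) (≈-sym (∑-⊕ ys (F x) _))

  ∑-guard : ∀ {A : Set} b (xs : List A) F → ∑ xs (λ x → b ⟦ F x ⟧) ≈ b ⟦ ∑ xs F ⟧
  ∑-guard true  xs F = ≈-refl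
  ∑-guard false xs F = ∑-0# xs

  -- Powers of q, q-integers and insertion statistics

  q^ : ℕ → Carrier
  q^ = pow R q

  q^-+ : ∀ m n → q^ (m + n) ≈ q^ m ⊛ q^ n
  q^-+ zero    n = ≈-sym (*-identityˡ _)
  q^-+ (suc m) n = ≈-trans (*-congˡ (q^-+ m n)) (≈-sym (*-assoc _ _ _))

  q^-cong : ∀ {m n} → m ≡ n → q^ m ≈ q^ n
  q^-cong refl = ≈-refl

  [_]q : ℕ → Carrier
  [ zero  ]q = 0#
  [ suc m ]q = q^ m ⊕ [ m ]q

  -- The definition splits off the top power; the descent case of `rmaj-behind` has to split off the
  -- constant term.
  []q-suc : ∀ m → [ suc m ]q ≈ 1# ⊕ q ⊛ [ m ]q
  []q-suc zero    = +-congˡ (≈-sym (zeroʳ q))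
  []q-suc (suc m) = begin
    q ⊛ q^ m ⊕ [ suc m ]q               ≈⟨ +-congˡ ([]q-suc m) ⟩
    q ⊛ q^ m ⊕ (1# ⊕ q ⊛ [ m ]q)        ≈⟨ x∙yz≈y∙xz _ _ _ ⟩
    1# ⊕ (q ⊛ q^ m ⊕ q ⊛ [ m ]q)        ≈⟨ +-congˡ (≈-sym (distribˡ q _ _)) ⟩
    1# ⊕ q ⊛ [ suc m ]q                 ∎

  -- All that the generating functions need to know of a statistic. `behind` records the increments
  -- 0, ..., `length τ` only through their sum, because inversions and rmaj attain them at different
  -- slots.
  record InsertionMahonian (st : List ℕ → ℕ) : Set ℓ where
    field
      singleton : ∀ x → st (x ∷ []) ≡ 0
      front     : ∀ {M} x τ → All (_< M) (x ∷ τ) → st (M ∷ x ∷ τ) ≡ suc (length τ) + st (x ∷ τ)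
      behind    : ∀ {M} x τ → All (_< M) (x ∷ τ) →
        ∑ (insertAll M τ) (λ z → q^ (st (x ∷ z))) ≈ [ suc (length τ) ]q ⊛ q^ (st (x ∷ τ))

  -- A mutual induction: a fixed head has the same inversions wherever `M` goes, which leaves all
  -- slots of `τ`; these split into the front slot and those behind the next head.
  inversions-behind : ∀ {M} x τ → All (_< M) (x ∷ τ) →
    ∑ (insertAll M τ) (λ z → q^ (inversions (x ∷ z))) ≈ [ suc (length τ) ]q ⊛ q^ (inversions (x ∷ τ))
  inversions-anywhere : ∀ {M} τ → All (_< M) τ →
    ∑ (insertAll M τ) (q^ ∘ inversions) ≈ [ suc (length τ) ]q ⊛ q^ (inversions τ)

  inversions-behind {M} x τ (x< ∷ τ<) = begin
    ∑ (insertAll M τ) (λ z → q^ (inversions (x ∷ z)))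
      ≈⟨ ∑-cong (insertAll M τ) (λ {z} z∈ → ≈-trans (q^-cong (cong (_+ inversions z)
           (trans (smaller-↭ x (insertAll-↭ τ z∈)) (smaller-∷-≥ τ (<⇒≤ x<))))) (q^-+ (smaller x τ) _)) ⟩
    ∑ (insertAll M τ) (λ z → q^ (smaller x τ) ⊛ q^ (inversions z)) ≈⟨ ∑-⊛ _ (insertAll M τ) _ ⟩
    q^ (smaller x τ) ⊛ ∑ (insertAll M τ) (q^ ∘ inversions)        ≈⟨ *-congˡ (inversions-anywhere τ τ<) ⟩
    q^ (smaller x τ) ⊛ ([ suc (length τ) ]q ⊛ q^ (inversions τ))  ≈⟨ x*yz≈y*xz _ _ _ ⟩
    [ suc (length τ) ]q ⊛ (q^ (smaller x τ) ⊛ q^ (inversions τ))  ≈⟨ *-congˡ (≈-sym (q^-+ (smaller x τ) _)) ⟩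
    [ suc (length τ) ]q ⊛ q^ (inversions (x ∷ τ))                 ∎

  inversions-anywhere []          _  = ≈-sym (*-identityʳ _)
  inversions-anywhere {M} (x ∷ τ) τ< = begin
    q^ (inversions (M ∷ x ∷ τ)) ⊕ ∑ (map (x ∷_) (insertAll M τ)) (q^ ∘ inversions)
      ≈⟨ +-cong (≈-trans (q^-cong (cong (_+ inversions (x ∷ τ)) (smaller-all (x ∷ τ) τ<))) (q^-+ (length (x ∷ τ)) _))
                (≈-trans (∑-map (x ∷_) (insertAll M τ) _) (inversions-behind x τ τ<)) ⟩
    q^ (length (x ∷ τ)) ⊛ q^ (inversions (x ∷ τ)) ⊕ [ suc (length τ) ]q ⊛ q^ (inversions (x ∷ τ))
      ≈⟨ ≈-sym (distribʳ _ _ _) ⟩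
    [ suc (length (x ∷ τ)) ]q ⊛ q^ (inversions (x ∷ τ)) ∎

  inversions-mahonian : InsertionMahonian inversions
  inversions-mahonian = record
    { singleton = λ _ → refl
    ; front     = λ x τ τ< → cong (_+ inversions (x ∷ τ)) (smaller-all (x ∷ τ) τ<)
    ; behind    = inversions-behind
    }

  -- Let `y` follow `x`. If `y < x`, inserting `M` between them replaces the descent by one of equal
  -- weight and adds 0, while any later slot makes the descent at `x` heavier by 1, giving 1, ...,
  -- `s`. Otherwise the slot between them creates a descent of weight `s`, and the later slots give
  -- 0, ..., `s` - 1.
  rmaj-behind : ∀ {M} x τ → All (_< M) (x ∷ τ) →
    ∑ (insertAll M τ) (λ z → q^ (rmajFrom x z)) ≈ [ suc (length τ) ]q ⊛ q^ (rmajFrom x τ)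
  rmaj-behind x [] (x< ∷ _) rewrite <ᵇ-false (<⇒≤ x<) = ≈-sym (*-identityʳ _)
  rmaj-behind {M} x (y ∷ τ) (x< ∷ y< ∷ τ<)
    rewrite <ᵇ-false (<⇒≤ x<) | <ᵇ-true y< with y <ᵇ x in eq
  ... | true = begin
    q^ (s + r) ⊕ ∑ (map (y ∷_) (insertAll M τ)) (λ z → q^ (rmajFrom x z))
      ≈⟨ +-congˡ (≈-trans (∑-map (y ∷_) (insertAll M τ) _) (∑-cong (insertAll M τ) (λ {z} z∈ → ≈-trans (q^-cong (descent z z∈)) (q^-+ (suc s) _)))) ⟩
    q^ (s + r) ⊕ ∑ (insertAll M τ) (λ z → q^ (suc s) ⊛ q^ (rmajFrom y z))
      ≈⟨ +-congˡ (≈-trans (∑-⊛ _ (insertAll M τ) _) (*-congˡ (rmaj-behind y τ (y< ∷ τ<)))) ⟩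
    q^ (s + r) ⊕ (q ⊛ q^ s) ⊛ ([ s ]q ⊛ q^ r)
      ≈⟨ +-cong (≈-sym (*-identityˡ _)) (≈-trans (*-assoc _ _ _) (≈-trans (*-congˡ (x*yz≈y*xz _ _ _)) (≈-trans (≈-sym (*-assoc _ _ _)) (*-congˡ (≈-sym (q^-+ s r)))))) ⟩
    1# ⊛ q^ (s + r) ⊕ (q ⊛ [ s ]q) ⊛ q^ (s + r)  ≈⟨ ≈-sym (distribʳ _ _ _) ⟩
    (1# ⊕ q ⊛ [ s ]q) ⊛ q^ (s + r)               ≈⟨ *-congʳ (≈-sym ([]q-suc s)) ⟩
    [ suc s ]q ⊛ q^ (s + r)                      ∎
    where
    s = suc (length τ)
    r = rmajFrom y τ
    descent : ∀ z → z ∈ insertAll M τ → rmajFrom x (y ∷ z) ≡ suc s + rmajFrom y z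
    descent z z∈ rewrite eq = cong (λ l → suc l + rmajFrom y z) (↭-length (insertAll-↭ τ z∈))
  ... | false = begin
    q^ (s + r) ⊕ ∑ (map (y ∷_) (insertAll M τ)) (λ z → q^ (rmajFrom x z))
      ≈⟨ +-cong (q^-+ s r) (≈-trans (∑-map (y ∷_) (insertAll M τ) _) (∑-cong (insertAll M τ) (λ {z} _ → q^-cong (ascent z)))) ⟩
    q^ s ⊛ q^ r ⊕ ∑ (insertAll M τ) (λ z → q^ (rmajFrom y z)) ≈⟨ +-congˡ (rmaj-behind y τ (y< ∷ τ<)) ⟩
    q^ s ⊛ q^ r ⊕ [ s ]q ⊛ q^ r                               ≈⟨ ≈-sym (distribʳ _ _ _) ⟩
    [ suc s ]q ⊛ q^ r                                         ∎
    where
    s = suc (length τ)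
    r = rmajFrom y τ
    ascent : ∀ z → rmajFrom x (y ∷ z) ≡ rmajFrom y z
    ascent z rewrite eq = refl

  rmaj-mahonian : InsertionMahonian rmaj
  rmaj-mahonian = record
    { singleton = λ _ → refl
    ; front     = λ { {M} x τ (x< ∷ _) → cong (λ b → (if b then suc (length τ) else 0) + rmajFrom x τ) (<ᵇ-true x<) }
    ; behind    = rmaj-behind
    }

  -- Coefficient sequences in t, with `shiftBy1` as multiplication by t

  shiftBy1 : (ℕ → Carrier) → ℕ → Carrier
  shiftBy1 F zero    = 0#
  shiftBy1 F (suc k) = F k

  -- Σ_k Z u m k t^k = ∏_{1 ≤ j ≤ m} (1 + q + ⋯ + q^{j-1} + u t q^j)
  Z : Carrier → ℕ → ℕ → Carrier
  Z u zero    k = (0 ≡ᵇ k) ⟦ 1# ⟧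
  Z u (suc m) k = u ⊛ (q^ (suc m) ⊛ shiftBy1 (Z u m) k) ⊕ [ suc m ]q ⊛ Z u m k

  -- The step defining `Z` is linear, so it may be verified for one word at a time and then summed.
  ∑-recurrence : ∀ {A : Set} (xs : List A) (F : ℕ → A → Carrier) u v w k →
    ∑ xs (λ x → u ⊛ (v ⊛ shiftBy1 (λ k → F k x) k) ⊕ w ⊛ F k x) ≈
    u ⊛ (v ⊛ shiftBy1 (λ k → ∑ xs (F k)) k) ⊕ w ⊛ ∑ xs (F k)
  ∑-recurrence xs F u v w k = ≈-trans (∑-⊕ xs _ _) (+-cong
    (≈-trans (∑-⊛ u xs _) (*-congˡ (≈-trans (∑-⊛ v xs _) (*-congˡ (shifted k))))) (∑-⊛ w xs _))
    where
    shifted : ∀ k → ∑ xs (λ x → shiftBy1 (λ k → F k x) k) ≈ shiftBy1 (λ k → ∑ xs (F k)) k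
    shifted zero    = ∑-0# xs
    shifted (suc k) = ≈-refl

  shiftBy1-cong : ∀ {F G} → (∀ k → F k ≈ G k) → ∀ k → shiftBy1 F k ≈ shiftBy1 G k
  shiftBy1-cong e zero    = ≈-refl
  shiftBy1-cong e (suc k) = e k

  guard-shiftBy1 : ∀ b F k → b ⟦ shiftBy1 F k ⟧ ≈ shiftBy1 (λ k → b ⟦ F k ⟧) k
  guard-shiftBy1 true  F zero    = ≈-refl
  guard-shiftBy1 false F zero    = ≈-refl
  guard-shiftBy1 b     F (suc k) = ≈-refl

  module _ {st : List ℕ → ℕ} (mahonian : InsertionMahonian st) where
    open InsertionMahonian mahonian

    term : ℕ → List ℕ → Carrier
    term k ρ = (del ρ ≡ᵇ k) ⟦ q^ (st ρ) ⟧

    term-singleton : ∀ k x → term k (x ∷ []) ≈ (0 ≡ᵇ k) ⟦ 1# ⟧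
    term-singleton k x = guard-cong (0 ≡ᵇ k) (λ _ → q^-cong (singleton x))

    term-front : ∀ {M} k ρ {m} → length ρ ≡ suc m → All (_< M) ρ →
      term k (M ∷ ρ) ≈ q^ (suc m) ⊛ shiftBy1 (λ k → term k ρ) k
    term-front k (x ∷ τ) refl τ< = ≈-trans (guard-≡ _ (cong (_≡ᵇ k) (ins-zero-del x τ (All.head τ<)))) (go k)
      where
      go : ∀ k → (suc (del (x ∷ τ)) ≡ᵇ k) ⟦ q^ (st (_ ∷ x ∷ τ)) ⟧ ≈ q^ (suc (length τ)) ⊛ shiftBy1 (λ k → term k (x ∷ τ)) k
      go zero    = ≈-sym (zeroʳ _)
      go (suc k) = ≈-trans (guard-cong (del (x ∷ τ) ≡ᵇ k) (λ _ → ≈-trans (q^-cong (front x τ τ<)) (q^-+ (suc (length τ)) _)))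
                           (guard-⊛ (del (x ∷ τ) ≡ᵇ k) _ _)

    -- The number of minima is constant over these slots, so its condition leaves the sum and
    -- `behind` applies.
    term-behind : ∀ {M} k x τ → All (_< M) (x ∷ τ) →
      ∑ (insertAll M τ) (λ z → term k (x ∷ z)) ≈ [ suc (length τ) ]q ⊛ term k (x ∷ τ)
    term-behind {M} k x τ τ< = begin
      ∑ (insertAll M τ) (λ z → term k (x ∷ z))
        ≈⟨ ∑-cong (insertAll M τ) (λ z∈ → guard-≡ _ (cong (_≡ᵇ k) (insertAll-del x τ τ< z∈))) ⟩
      ∑ (insertAll M τ) (λ z → d ⟦ q^ (st (x ∷ z)) ⟧)   ≈⟨ ∑-guard d (insertAll M τ) _ ⟩
      d ⟦ ∑ (insertAll M τ) (λ z → q^ (st (x ∷ z))) ⟧   ≈⟨ guard-cong d (λ _ → behind x τ τ<) ⟩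
      d ⟦ [ suc (length τ) ]q ⊛ q^ (st (x ∷ τ)) ⟧       ≈⟨ guard-⊛ d _ _ ⟩
      [ suc (length τ) ]q ⊛ term k (x ∷ τ)              ∎
      where d = del (x ∷ τ) ≡ᵇ k

    term-insertAll : ∀ {M} k ρ {m} → length ρ ≡ suc m → All (_< M) ρ →
      ∑ (insertAll M ρ) (term k) ≈ q^ (suc m) ⊛ shiftBy1 (λ k → term k ρ) k ⊕ [ suc m ]q ⊛ term k ρ
    term-insertAll {M} k (x ∷ τ) refl τ< = +-cong (term-front k (x ∷ τ) refl τ<)
      (≈-trans (∑-map (x ∷_) (insertAll M τ) (term k)) (term-behind k x τ τ<))

    ∑-Sym : ∀ m k → ∑ (Sym (suc m)) (term k) ≈ Z 1# m k
    ∑-Sym zero    k = ≈-trans (+-identityʳ _) (term-singleton k 1)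
    ∑-Sym (suc m) k = begin
      ∑ (Sym N) (term k)                                  ≈⟨ ∑-↭ (term k) (Sym-suc (suc m)) ⟩
      ∑ (concatMap (insertAll N) (Sym (suc m))) (term k)  ≈⟨ ∑-concatMap (insertAll N) (Sym (suc m)) (term k) ⟩
      ∑ (Sym (suc m)) (λ τ → ∑ (insertAll N τ) (term k))
        ≈⟨ ∑-cong (Sym (suc m)) (λ {τ} τ∈ → let s = ∈-Sym⁻ (suc m) τ∈ in
             ≈-trans (term-insertAll k τ (len s) (perm-below s)) (+-congʳ (≈-sym (*-identityˡ _)))) ⟩
      ∑ (Sym (suc m)) (λ τ → 1# ⊛ (q^ (suc m) ⊛ shiftBy1 (λ k → term k τ) k) ⊕ [ suc m ]q ⊛ term k τ)
        ≈⟨ ∑-recurrence (Sym (suc m)) term 1# (q^ (suc m)) ([ suc m ]q) k ⟩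
      1# ⊛ (q^ (suc m) ⊛ shiftBy1 (λ k → ∑ (Sym (suc m)) (term k)) k) ⊕ [ suc m ]q ⊛ ∑ (Sym (suc m)) (term k)
        ≈⟨ +-cong (*-congˡ (*-congˡ (shiftBy1-cong (∑-Sym m) k))) (*-congˡ (∑-Sym m k)) ⟩
      Z 1# (suc m) k ∎
      where N = suc (suc m)

  -- Sums over one parity class through the bubble pass

  ∑-parity : ℕ → ℕ → (List ℕ → Carrier) → Carrier
  ∑-parity m e H = ∑ (Sym (suc (suc m))) (λ σ → isEven (e + inversions σ) ⟦ H (bubble σ) ⟧)

  -- Slot `p` adds `suc (suc m) ∸ p` inversions, which are absorbed into the parity offset `e`; on
  -- the pass it acts as `insBubble p`.
  ∑-parity-suc : ∀ m e H → ∑-parity (suc m) e H ≈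
    ∑ (upTo (suc (suc (suc m)))) (λ p → ∑-parity m (e + (suc (suc m) ∸ p)) (λ ρ → H (insBubble p (suc (suc (suc m))) ρ)))
  ∑-parity-suc m e H = begin
    ∑ (Sym M) G                                              ≈⟨ ∑-↭ G (Sym-suc N) ⟩
    ∑ (concatMap (insertAll M) (Sym N)) G                    ≈⟨ ∑-concatMap (insertAll M) (Sym N) G ⟩
    ∑ (Sym N) (λ τ → ∑ (insertAll M τ) G)                    ≈⟨ ∑-cong (Sym N) (λ {τ} τ∈ → inner-sum τ (∈-Sym⁻ N τ∈)) ⟩
    ∑ (Sym N) (λ τ → ∑ (upTo M) (λ p → isEven ((e + (N ∸ p)) + inversions τ) ⟦ H (insBubble p M (bubble τ)) ⟧))
      ≈⟨ ∑-swap (Sym N) (upTo M) _ ⟩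
    ∑ (upTo M) (λ p → ∑-parity m (e + (N ∸ p)) (λ ρ → H (insBubble p M ρ))) ∎
    where
    N = suc (suc m)
    M = suc N
    G : List ℕ → Carrier
    G σ = isEven (e + inversions σ) ⟦ H (bubble σ) ⟧
    at : ∀ τ → IsPerm N τ → ∀ p → p ≤ N →
      G (ins p M τ) ≈ isEven ((e + (N ∸ p)) + inversions τ) ⟦ H (insBubble p M (bubble τ)) ⟧
    at (x ∷ τ) s p p≤ = reflexive (cong₂ (λ b ρ → b ⟦ H ρ ⟧)
      (cong isEven (trans (cong (e +_) (trans (inversions-ins p (x ∷ τ) (perm-below s) (subst (p ≤_) (sym (len s)) p≤))
        (cong (λ l → l ∸ p + inversions (x ∷ τ)) (len s)))) (sym (ℕ.+-assoc e (N ∸ p) (inversions (x ∷ τ))))))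
      (bubble-ins p x τ (perm-below s)))
    inner-sum : ∀ τ → IsPerm N τ → ∑ (insertAll M τ) G ≈
      ∑ (upTo M) (λ p → isEven ((e + (N ∸ p)) + inversions τ) ⟦ H (insBubble p M (bubble τ)) ⟧)
    inner-sum τ s = begin
      ∑ (insertAll M τ) G ≈⟨ reflexive (cong (λ xs → ∑ xs G) (trans (insertAll-ins M τ) (cong (λ l → map (λ p → ins p M τ) (upTo (suc l))) (len s)))) ⟩
      ∑ (map (λ p → ins p M τ) (upTo M)) G ≈⟨ ∑-map (λ p → ins p M τ) (upTo M) G ⟩
      ∑ (upTo M) (λ p → G (ins p M τ))     ≈⟨ ∑-cong (upTo M) (λ {p} p∈ → at τ s p (s≤s⁻¹ (∈-upTo⁻ p∈))) ⟩
      ∑ (upTo M) (λ p → isEven ((e + (N ∸ p)) + inversions τ) ⟦ H (insBubble p M (bubble τ)) ⟧) ∎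

  -- For two letters, the even and the odd word have the same pass. In the step, `e` enters only the
  -- offsets of the sums for `m`, and the induction hypothesis, available for every `H`, resets each
  -- of them to 0.
  ∑-parity-even : ∀ m e H → ∑-parity m e H ≈ ∑-parity m 0 H
  ∑-parity-even zero e H rewrite ℕ.+-comm e 0 | ℕ.+-comm e 1 with isEven e
  ... | true  = ≈-refl
  ... | false = x∙yz≈y∙xz _ _ _
  ∑-parity-even (suc m) e H = ≈-trans (∑-parity-suc m e H) (≈-trans
    (∑-cong (upTo (suc (suc (suc m)))) (λ {p} _ →
      ≈-trans (∑-parity-even m (e + (suc (suc m) ∸ p)) (H′ p)) (≈-sym (∑-parity-even m (suc (suc m) ∸ p) (H′ p)))))
    (≈-sym (∑-parity-suc m 0 H)))
    where
    H′ : ℕ → List ℕ → Carrier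
    H′ p ρ = H (insBubble p (suc (suc (suc m))) ρ)

  -- Slots 0 and 1 of the word both put `M` in front of `ρ`: one of them is the extra summand, the
  -- other is the first entry of `insertAll M ρ`.
  ∑-insBubble : ∀ {M} ρ H →
    ∑ (upTo (suc (suc (length ρ)))) (λ p → H (insBubble p M ρ)) ≈ H (M ∷ ρ) ⊕ ∑ (insertAll M ρ) H
  ∑-insBubble {M} ρ H = +-congˡ (begin
    ∑ (applyUpTo suc (suc (length ρ))) (λ p → H (insBubble p M ρ))
      ≈⟨ reflexive (cong (λ xs → ∑ xs (λ p → H (insBubble p M ρ))) (sym (map-applyUpTo id suc (suc (length ρ))))) ⟩
    ∑ (map suc (upTo (suc (length ρ)))) (λ p → H (insBubble p M ρ)) ≈⟨ ∑-map suc (upTo (suc (length ρ))) _ ⟩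
    ∑ (upTo (suc (length ρ))) (λ p → H (ins p M ρ))                ≈⟨ ≈-sym (∑-map (λ p → ins p M ρ) (upTo (suc (length ρ))) H) ⟩
    ∑ (map (λ p → ins p M ρ) (upTo (suc (length ρ)))) H            ≈⟨ reflexive (cong (λ xs → ∑ xs H) (sym (insertAll-ins M ρ))) ⟩
    ∑ (insertAll M ρ) H                                            ∎)

  -- Once all offsets are reset to 0, the slots share one sum over even words and can be summed
  -- inside it.
  ∑-even-suc : ∀ m H → ∑-parity (suc m) 0 H ≈
    ∑-parity m 0 (λ ρ → ∑ (upTo (suc (suc (suc m)))) (λ p → H (insBubble p (suc (suc (suc m))) ρ)))
  ∑-even-suc m H = begin
    ∑-parity (suc m) 0 H ≈⟨ ∑-parity-suc m 0 H ⟩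
    ∑ (upTo M) (λ p → ∑-parity m (suc (suc m) ∸ p) (λ ρ → H (insBubble p M ρ)))
      ≈⟨ ∑-cong (upTo M) (λ {p} _ → ∑-parity-even m (suc (suc m) ∸ p) (λ ρ → H (insBubble p M ρ))) ⟩
    ∑ (upTo M) (λ p → ∑-parity m 0 (λ ρ → H (insBubble p M ρ)))
      ≈⟨ ∑-swap (upTo M) (Sym (suc (suc m))) _ ⟩
    ∑ (Sym (suc (suc m))) (λ σ → ∑ (upTo M) (λ p → isEven (inversions σ) ⟦ H (insBubble p M (bubble σ)) ⟧))
      ≈⟨ ∑-cong (Sym (suc (suc m))) (λ {σ} _ → ∑-guard (isEven (inversions σ)) (upTo M) _) ⟩
    ∑-parity m 0 (λ ρ → ∑ (upTo M) (λ p → H (insBubble p M ρ))) ∎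
    where M = suc (suc (suc m))

  module _ {st : List ℕ → ℕ} (mahonian : InsertionMahonian st) where
    -- The recurrence of `∑-Sym` for the pass, except that the front insertion occurs twice; hence
    -- the weight `1# ⊕ 1#`.
    ∑-Alt : ∀ m k → ∑-parity m 0 (term mahonian k) ≈ Z (1# ⊕ 1#) m k
    ∑-Alt zero    k = ≈-trans (+-congˡ (+-identityʳ 0#)) (≈-trans (+-identityʳ _) (term-singleton mahonian k 2))
    ∑-Alt (suc m) k = begin
      ∑-parity (suc m) 0 (t k) ≈⟨ ∑-even-suc m (t k) ⟩
      ∑-parity m 0 (λ ρ → ∑ (upTo M) (λ p → t k (insBubble p M ρ)))
        ≈⟨ ∑-cong (Sym N) (λ {σ} σ∈ → step σ (∈-Sym⁻ N σ∈)) ⟩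
      ∑ (Sym N) (λ σ → u ⊛ (v ⊛ shiftBy1 (λ k → F k σ) k) ⊕ w ⊛ F k σ)
        ≈⟨ ∑-recurrence (Sym N) F u v w k ⟩
      u ⊛ (v ⊛ shiftBy1 (λ k → ∑-parity m 0 (t k)) k) ⊕ w ⊛ ∑-parity m 0 (t k)
        ≈⟨ +-cong (*-congˡ (*-congˡ (shiftBy1-cong (∑-Alt m) k))) (*-congˡ (∑-Alt m k)) ⟩
      Z u (suc m) k ∎
      where
      N = suc (suc m)
      M = suc N
      t = term mahonian
      u = 1# ⊕ 1#
      v = q^ (suc m)
      w = [ suc m ]q
      F : ℕ → List ℕ → Carrier
      F k σ = isEven (inversions σ) ⟦ t k (bubble σ) ⟧
      insertions : ∀ ρ → length ρ ≡ suc m → All (_< M) ρ → ∑ (upTo M) (λ p → t k (insBubble p M ρ)) ≈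
        u ⊛ (v ⊛ shiftBy1 (λ k → t k ρ) k) ⊕ w ⊛ t k ρ
      insertions ρ l ρ< = begin
        ∑ (upTo M) (λ p → t k (insBubble p M ρ)) ≈⟨ reflexive (cong (λ l → ∑ (upTo (suc (suc l))) (λ p → t k (insBubble p M ρ))) (sym l)) ⟩
        ∑ (upTo (suc (suc (length ρ)))) (λ p → t k (insBubble p M ρ)) ≈⟨ ∑-insBubble ρ (t k) ⟩
        t k (M ∷ ρ) ⊕ ∑ (insertAll M ρ) (t k)
          ≈⟨ +-cong (term-front mahonian k ρ l ρ<) (term-insertAll mahonian k ρ l ρ<) ⟩
        y ⊕ (y ⊕ w ⊛ t k ρ)         ≈⟨ ≈-sym (+-assoc _ _ _) ⟩
        (y ⊕ y) ⊕ w ⊛ t k ρ         ≈⟨ +-congʳ (+-cong (≈-sym (*-identityˡ y)) (≈-sym (*-identityˡ y))) ⟩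
        (1# ⊛ y ⊕ 1# ⊛ y) ⊕ w ⊛ t k ρ ≈⟨ +-congʳ (≈-sym (distribʳ y 1# 1#)) ⟩
        u ⊛ y ⊕ w ⊛ t k ρ           ∎
        where y = v ⊛ shiftBy1 (λ k → t k ρ) k
      step : ∀ σ → IsPerm N σ → isEven (inversions σ) ⟦ ∑ (upTo M) (λ p → t k (insBubble p M (bubble σ))) ⟧ ≈
        u ⊛ (v ⊛ shiftBy1 (λ k → F k σ) k) ⊕ w ⊛ F k σ
      step σ s = begin
        b ⟦ ∑ (upTo M) (λ p → t k (insBubble p M (bubble σ))) ⟧
          ≈⟨ guard-cong b (λ _ → insertions (bubble σ) (length-bubble σ (len s)) (bubble-All σ (perm-below s))) ⟩
        b ⟦ u ⊛ (v ⊛ shiftBy1 (λ k → t k (bubble σ)) k) ⊕ w ⊛ t k (bubble σ) ⟧ ≈⟨ guard-⊕ b _ _ ⟩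
        b ⟦ u ⊛ (v ⊛ shiftBy1 (λ k → t k (bubble σ)) k) ⟧ ⊕ b ⟦ w ⊛ t k (bubble σ) ⟧
          ≈⟨ +-cong (≈-trans (guard-⊛ b u _) (*-congˡ (≈-trans (guard-⊛ b v _) (*-congˡ (guard-shiftBy1 b _ k))))) (guard-⊛ b w _) ⟩
        u ⊛ (v ⊛ shiftBy1 (λ k → F k σ) k) ⊕ w ⊛ F k σ ∎
        where b = isEven (inversions σ)

    -- Evaluation of the sums over fixed del

    genSum-BS : ∀ m k (stat : List ℕ → ℕ) → (∀ {σ} → IsPerm (suc m) σ → stat σ ≡ st σ) →
      genSum R q stat (BS (suc m) k) ≈ Z 1# m k
    genSum-BS m k stat agree = begin
      ∑ (BS (suc m) k) (q^ ∘ stat) ≈⟨ ∑-filter (λ σ → delS (suc m) σ ≡ᵇ k) (Sym (suc m)) _ ⟩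
      ∑ (Sym (suc m)) (λ σ → (delS (suc m) σ ≡ᵇ k) ⟦ q^ (stat σ) ⟧)
        ≈⟨ ∑-cong (Sym (suc m)) (λ σ∈ → let s = ∈-Sym⁻ (suc m) σ∈ in
             reflexive (cong₂ (λ d l → (d ≡ᵇ k) ⟦ q^ l ⟧) (delS-del s) (agree s))) ⟩
      ∑ (Sym (suc m)) (term mahonian k) ≈⟨ ∑-Sym mahonian m k ⟩
      Z 1# m k ∎

    genSum-BA : ∀ m k (stat : List ℕ → ℕ) →
      (∀ {σ} → IsPerm (suc (suc m)) σ → isEven (inversions σ) ≡ true → stat σ ≡ st (bubble σ)) →
      genSum R q stat (BA (suc m) k) ≈ Z (1# ⊕ 1#) m k
    genSum-BA m k stat agree = begin
      ∑ (BA (suc m) k) (q^ ∘ stat) ≈⟨ ∑-filter (λ σ → delA (suc m) σ ≡ᵇ k) (Alt N) _ ⟩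
      ∑ (Alt N) (λ σ → (delA (suc m) σ ≡ᵇ k) ⟦ q^ (stat σ) ⟧) ≈⟨ ∑-filter (λ σ → inversions σ % 2 ≡ᵇ 0) (Sym N) _ ⟩
      ∑ (Sym N) (λ σ → (inversions σ % 2 ≡ᵇ 0) ⟦ (delA (suc m) σ ≡ᵇ k) ⟦ q^ (stat σ) ⟧ ⟧)
        ≈⟨ ∑-cong (Sym N) (λ {σ} σ∈ → let s = ∈-Sym⁻ N σ∈ in
             -- The parity guard supplies the evenness under which `delA` and `stat` are known on
             -- the pass.
             ≈-trans (guard-≡ _ (%2≡ᵇ0 (inversions σ))) (guard-cong (isEven (inversions σ)) (λ even →
               reflexive (cong₂ (λ d l → (d ≡ᵇ k) ⟦ q^ l ⟧) (proj₂ (factorA-stats s even)) (agree s even))))) ⟩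
      ∑-parity m 0 (term mahonian k) ≈⟨ ∑-Alt m k ⟩
      Z (1# ⊕ 1#) m k ∎
      where N = suc (suc m)

theorem6p2 : ∀ {c ℓ} (n k : ℕ) → 1 ≤ n → k ≤ n ∸ 1 →
    (R : CommutativeSemiring c ℓ) → (q : CommutativeSemiring.Carrier R) →
    (CommutativeSemiring._≈_ R (genSum R q inversions (BS n k)) (genSum R q (rmajS n) (BS n k)))
    × (CommutativeSemiring._≈_ R (genSum R q (lenA n) (BA n k)) (genSum R q (rmajA n) (BA n k)))
theorem6p2 (suc m) k _ _ R q =
  ≈-trans (genSum-BS inversions-mahonian m k inversions (λ _ → refl))
    (≈-sym (genSum-BS rmaj-mahonian m k (rmajS (suc m)) (λ {σ} s → trans (cong (λ n → rmajS n σ) (sym (len s))) (rmajS-rmaj σ)))) ,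
  ≈-trans (genSum-BA inversions-mahonian m k (lenA (suc m)) (λ s even → proj₁ (factorA-stats s even)))
    (≈-sym (genSum-BA rmaj-mahonian m k (rmajA (suc m)) rmajA-rmaj))
  where
  open CommutativeSemiring R using () renaming (sym to ≈-sym; trans to ≈-trans)
  open GeneratingFunctions R q
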